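{- For every integer $n\ge 2$, \[ \mathsf{InstC}(\mathsf{CONN}) = \frac{\mathsf{DT}(\mathsf{CONN})}{\mathsf{C}_{\mathsf{min}}(\mathsf{CONN})} = \frac{\binom{n}{2}}{n-1}. \] Moreover, there is an absolute constant $c>0$ such that for all integers $n \ge 2$ and $k$ with $2\le k\le c\, n^{2/3}$, \[ \mathsf{InstC}(\mathsf{CL}_{k}) = \frac{\mathsf{DT}(\mathsf{CL}_{k})}{\mathsf{C}_{\mathsf{min}}(\mathsf{CL}_{k})} = \frac{\binom{n}{2}}{\binom{k}{2}}. \]
   Context: Graphs on the vertex set $[n]$ are encoded as strings in $\{0,1\}^{\binom{n}{2}}$, one bit per unordered pair of vertices, the bit being 1 iff the edge is present. $\mathsf{CONN}:\{0,1\}^{\binom n2}\to\{0,1\}$ outputs 1 iff the graph is connected; $\mathsf{CL}_k:\{0,1\}^{\binom n2}\to\{0,1\}$ outputs 1 iff the graph contains a $k$-clique as a subgraph. For a Boolean function $f$ on $N$ variables: a deterministic decision tree is a rooted binary tree with internal nodes labeled by variables, edges labeled $0/1$, leaves labeled by outputs in $\{0,1\}$, evaluating an input by following the path determined by queried values; it computes $f$ if it outputs $f(x)$ for all $x$; $\mathcal{T}(x)$ is the number of queries on $x$. $\mathsf{DT}(f)$ is the minimum depth of a decision tree computing $f$. A certificate for $x$ is a set $S$ of variables such that $f(y)=f(x)$ for all $y$ agreeing with $x$ on $S$; $\mathsf{C}(f,x)$ is its minimum size; $\mathsf{C}_{\mathsf{min}}(f)=\min_x\mathsf{C}(f,x)$.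 $\mathsf{InstC}(f)=\min_{\mathcal{T}}\max_x \frac{\mathcal{T}(x)}{\mathsf{C}(f,x)}$ over decision trees $\mathcal{T}$ computing $f$. -}

module Defs where

open import Data.Nat using (ℕ; zero; suc; _+_; _*_; _≤_; _<_; _≥_; _^_; _∸_)
open import Data.Bool using (Bool; true; false)
open import Data.Fin using (Fin; inject₁; fromℕ)
open import Data.Fin.Subset using (Subset; _∈_; ∣_∣)
open import Data.Vec using (Vec; []; _++_; tabulate; map; lookup)
open import Data.Product using (_×_; _,_; ∃; ∃-syntax; Σ)
open import Data.Sum using (_⊎_)
open import Function.Bundles using (_⇔_)
open import Relation.Binary.PropositionalEquality using (_≡_)
open import Relation.Nullary using (¬_)

-- Boolean functions on N variables.
-- A Boolean function f : {0,1}^N → {0,1} is represented by the predicate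
-- "f(x) = 1", i.e. a map  (Fin N → Bool) → Set.

BoolFun : ℕ → Set₁
BoolFun N = (Fin N → Bool) → Set

-- Deterministic decision trees: a leaf carries the output bit, an
-- internal node queries variable i; first subtree = answer 0 (false),
-- second subtree = answer 1 (true).
data DTree (N : ℕ) : Set where
  leaf : Bool → DTree N
  node : Fin N → DTree N → DTree N → DTree N

eval : ∀ {N} → DTree N → (Fin N → Bool) → Bool
eval (leaf b) x = b
eval (node i t₀ t₁) x with x i
... | false = eval t₀ x
... | true  = eval t₁ x

cost : ∀ {N} → DTree N → (Fin N → Bool) → ℕ
cost (leaf b) x = 0
cost (node i t₀ t₁) x with x i
... | false = suc (cost t₀ x)
... | true  = suc (cost t₁ x)

depth : ∀ {N} → DTree N → ℕ
depth (leaf b) = 0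
depth (node i t₀ t₁) = suc (depth t₀ Data.Nat.⊔ depth t₁)

Computes : ∀ {N} → BoolFun N → DTree N → Set
Computes f T = ∀ x → (eval T x ≡ true) ⇔ f x

IsDT : ∀ {N} → BoolFun N → ℕ → Set
IsDT f d = (∃[ T ] (Computes f T × depth T ≡ d))
         × (∀ T → Computes f T → d ≤ depth T)

IsCert : ∀ {N} → BoolFun N → (Fin N → Bool) → Subset N → Set
IsCert f x S = ∀ y → (∀ i → i ∈ S → y i ≡ x i) → (f y ⇔ f x)

IsC : ∀ {N} → BoolFun N → (Fin N → Bool) → ℕ → Set
IsC f x c = (∃[ S ] (IsCert f x S × ∣ S ∣ ≡ c))
          × (∀ S → IsCert f x S → c ≤ ∣ S ∣)

IsCmin : ∀ {N} → BoolFun N → ℕ → Set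
IsCmin f m = (∃[ x ] IsC f x m) × (∀ x c → IsC f x c → m ≤ c)

-- InstC(f) = a / b  (b ≠ 0), with rationals compared by cross-multiplication:
--   min over trees T computing f of  max_x T(x)/C(f,x)  equals a/b, i.e.
--   (i) some T computing f has T(x)/C(f,x) ≤ a/b for all x, and
--   (ii) every T computing f has some x with T(x)/C(f,x) ≥ a/b.
IsInstC : ∀ {N} → BoolFun N → ℕ → ℕ → Set
IsInstC f a b =
    (∃[ T ] (Computes f T × (∀ x c → IsC f x c → cost T x * b ≤ a * c)))
  × (∀ T → Computes f T → ∃[ x ] ∃[ c ] (IsC f x c × a * c ≤ cost T x * b))

-- number of unordered pairs of [n]  (equals n choose 2)
E : ℕ → ℕ
E zero = 0
E (suc n) = n + E n

-- enumeration of the unordered pairs {i,j} (i < j) of Fin n;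
-- variable e ∈ Fin (E n) is the bit of pair  lookup (pairs n) e
pairs : (n : ℕ) → Vec (Fin n × Fin n) (E n)
pairs zero = []
pairs (suc n) =
  tabulate (λ i → (inject₁ i , fromℕ n))
  ++ map (λ p → (inject₁ (Data.Product.proj₁ p) , inject₁ (Data.Product.proj₂ p))) (pairs n)

Graph : ℕ → Set
Graph n = Fin (E n) → Bool

Adj : (n : ℕ) → Graph n → Fin n → Fin n → Set
Adj n x i j = ∃[ e ] ((lookup (pairs n) e ≡ (i , j) ⊎ lookup (pairs n) e ≡ (j , i))
                        × x e ≡ true)

data Reach (n : ℕ) (x : Graph n) (i : Fin n) : Fin n → Set where
  here : Reach n x i i
  step : ∀ {j k} → Reach n x i j → Adj n x j k → Reach n x i k

CONN : (n : ℕ) → BoolFun (E n)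
CONN n x = ∀ i j → Reach n x i j

CL : (n k : ℕ) → BoolFun (E n)
CL n k x = ∃[ S ] (∣ S ∣ ≡ k × (∀ i j → i ∈ S → j ∈ S → ¬ (i ≡ j) → Adj n x i j))

{-# OPTIONS --safe #-}
module Submission where

-- If a function on N variables has all certificates of size at least m, and
-- an adversary can force N queries on some input with a certificate of size
-- m, then every tree reading all variables is instance optimal with ratio N/m.
--
-- CONN, adversary: answer 1 exactly when the queried edge is the last unqueried
-- edge between two components of the graph of 1-answers. All edges get queried,
-- and the 1-answers form a spanning tree.
--
-- CL_k, adversary: fix k-2 hubs. As long as the 1-edges off the hubs contain no
-- triangle, a k-clique consists of all hubs and a 1-edge uv off the hubs all of
-- whose spokes (edges from u and v to hubs) are 1. Edges off the hubs are
-- answered 0 and spokes 1, except that a vertex whose last edge off the hubs is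
-- queried while it has open spokes is hung as a leaf from the other end of that
-- edge; then its last spoke is answered 0, unless its parent would be left with
-- useless open spokes, in which case the answer is 1 and parent and leaf
-- exchange roles. Thus no open edge ever becomes irrelevant.
--
-- CL_k, certificates: a 1-certificate contains the edges of a k-clique; a
-- 0-certificate meets all k-sets, so by a greedy colouring it has at least
-- k² edges when 8k³ ≤ n².

open import Defs
open import Data.Bool using (Bool; true; false; not; _∧_; if_then_else_)
import Data.Bool.Properties as Bool
open import Data.Empty using (⊥; ⊥-elim)
open import Data.Fin using (Fin; zero; suc; toℕ; fromℕ<; inject₁; fromℕ; _≟_; _↑ˡ_; _↑ʳ_; splitAt; punchIn; punchOut)
open import Data.Fin.Properties using (suc-injective; any?; all?; toℕ-injective; toℕ-inject₁; toℕ-fromℕ; toℕ<n; inject₁-injective; fromℕ≢inject₁; splitAt⁻¹-↑ˡ; splitAt⁻¹-↑ʳ; toℕ-fromℕ<; punchInᵢ≢i; punchIn-injective; punchOut-punchIn; punchOut-cong; punchOut-injective)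
open import Data.Fin.Relation.Unary.Top using (view; view-fromℕ; view-inject₁; ‵fromℕ; ‵inject₁)
open import Data.Fin.Subset.Properties using (anySubset?; _∈?_)
open import Data.Fin.Subset using (Subset; ∣_∣) renaming (_∈_ to _∈ₛ_)
open import Data.Maybe using (Maybe; just; nothing)
open import Data.Nat using (ℕ; zero; suc; _+_; _*_; _≤_; _<_; _∸_; _^_; z≤n; s≤s; s≤s⁻¹; _≤?_; _<?_)
import Data.Nat as ℕ
open import Data.Nat.Combinatorics using (_C_; nC1≡n; nCk+nC[k+1]≡[n+1]C[k+1])
open import Data.Nat.DivMod using (_/_; _%_; m≡m%n+[m/n]*n; m/n*n≤m; m%n≤n; m≥n⇒m/n>0)
open import Data.Nat.Solver using (module +-*-Solver)
open import Data.Nat.Properties hiding (_≟_; suc-injective)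
open import Data.Product using (_×_; _,_; ∃-syntax; Σ; proj₁; proj₂)
open import Data.Product.Properties using (,-injective; ≡-dec)
open import Data.Sum using (_⊎_; inj₁; inj₂; swap; [_,_]′)
open import Data.Vec using (Vec; []; _∷_; tabulate; lookup)
open import Data.Vec.Properties using (lookup∘tabulate; []=⇒lookup; lookup⇒[]=; lookup-++ˡ; lookup-++ʳ; lookup-map)
open import Function using (_∘_; _⇔_; Equivalence; mk⇔)
open import Relation.Binary.PropositionalEquality
open import Relation.Nullary using (¬_; Dec; yes; no; does)
open import Relation.Nullary.Decidable using (dec-true; dec-false; _×-dec_; _⊎-dec_; _→-dec_; ¬?; map′)

-- Evasiveness alone would not give the ratio: the input that costs all N queries must itself have a
-- certificate of size m. Both adversaries therefore steer towards a 1-input whose 1-answers contain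
-- a spanning tree or a clique, and must keep both values possible until the very last query.
--
-- For cliques the danger is an edge that ceases to matter. A vertex off the hubs all of whose edges
-- to other such vertices were answered 0 lies in no relevant clique, and a tree could skip its
-- spokes. A 1 on the last of these edges keeps the spokes alive, but prepares a clique; a later 0
-- on a spoke of the leaf defuses it. Each such 1-edge is recorded as a parent link, and open edges
-- off the hubs join only vertices without parent; such vertices have no common neighbour, so no
-- triangle arises.
--
-- The exponent 2/3 comes from the certificates: a set of edges meeting all k-sets has order n²/k
-- elements, which must reach the order k² of the edges of a clique. The adversary itself works for
-- 2 ≤ k ≤ n.

true≢false : {A : Set} {b : Bool} → b ≡ true → b ≡ false → A
true≢false refl ()

does⇒ : {P : Set} (d : Dec P) → does d ≡ true → P
does⇒ (yes p) _ = p

-- Counting with Boolean predicates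

bit : Bool → ℕ
bit false = 0
bit true  = 1

cnt : ∀ {N} → (Fin N → Bool) → ℕ
cnt {zero}  p = 0
cnt {suc N} p = bit (p zero) + cnt (p ∘ suc)

cnt-cong : ∀ {N} {p q : Fin N → Bool} → (∀ i → p i ≡ q i) → cnt p ≡ cnt q
cnt-cong {zero}  h = refl
cnt-cong {suc N} h = cong₂ _+_ (cong bit (h zero)) (cnt-cong (h ∘ suc))

cnt-mono : ∀ {N} {p q : Fin N → Bool} → (∀ i → p i ≡ true → q i ≡ true) → cnt p ≤ cnt q
cnt-mono {zero}          h = z≤n
cnt-mono {suc N} {p} {q} h = +-mono-≤ (bit-mono (h zero)) (cnt-mono (h ∘ suc))
  where
  bit-mono : ∀ {a b} → (a ≡ true → b ≡ true) → bit a ≤ bit b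
  bit-mono {false}        _ = z≤n
  bit-mono {true} {true}  _ = ≤-refl
  bit-mono {true} {false} k = true≢false (k refl) refl

cnt-all : ∀ {N} {p : Fin N → Bool} → (∀ i → p i ≡ true) → cnt p ≡ N
cnt-all {zero}  h = refl
cnt-all {suc N} h rewrite h zero = cong suc (cnt-all (h ∘ suc))

cnt-none : ∀ {N} {p : Fin N → Bool} → (∀ i → p i ≡ false) → cnt p ≡ 0
cnt-none {zero}  h = refl
cnt-none {suc N} h rewrite h zero = cnt-none (h ∘ suc)

cnt-flip : ∀ {N} {p q : Fin N → Bool} (i : Fin N) → p i ≡ true → q i ≡ false →
           (∀ j → j ≢ i → p j ≡ q j) → cnt p ≡ suc (cnt q)
cnt-flip zero    pi qi h rewrite pi | qi = cong suc (cnt-cong λ j → h (suc j) λ ())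
cnt-flip {p = p} {q} (suc i) pi qi h =
  trans (cong₂ _+_ (cong bit (h zero λ ()))
                   (cnt-flip {p = p ∘ suc} {q ∘ suc} i pi qi λ j ne → h (suc j) (ne ∘ suc-injective)))
        (+-suc (bit (q zero)) _)

cnt-witness : ∀ {N} {p : Fin N → Bool} → 1 ≤ cnt p → ∃[ i ] p i ≡ true
cnt-witness {suc N} {p} h with p zero in eq
... | true  = zero , eq
... | false = let i , pi = cnt-witness {p = p ∘ suc} h in suc i , pi

cnt-split : ∀ {N} (p q : Fin N → Bool) →
            cnt p ≡ cnt (λ i → p i ∧ q i) + cnt (λ i → p i ∧ not (q i))
cnt-split {zero}  p q = refl
cnt-split {suc N} p q with p zero | q zero
... | false | _     = cnt-split (p ∘ suc) (q ∘ suc)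
... | true  | true  = cong suc (cnt-split (p ∘ suc) (q ∘ suc))
... | true  | false = trans (cong suc (cnt-split (p ∘ suc) (q ∘ suc))) (sym (+-suc _ _))

cnt-last : ∀ {n} (p : Fin (suc n) → Bool) → cnt p ≡ bit (p (fromℕ n)) + cnt (p ∘ inject₁)
cnt-last {zero}  p = refl
cnt-last {suc n} p = begin
  bit (p zero) + cnt (p ∘ suc)                                     ≡⟨ cong (bit (p zero) +_) (cnt-last (p ∘ suc)) ⟩
  bit (p zero) + (bit (p (fromℕ (suc n))) + cnt (p ∘ inject₁ ∘ suc)) ≡⟨ x∙yz≈y∙xz (bit (p zero)) (bit (p (fromℕ (suc n)))) (cnt (p ∘ inject₁ ∘ suc)) ⟩
  bit (p (fromℕ (suc n))) + (bit (p zero) + cnt (p ∘ inject₁ ∘ suc)) ∎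
  where
  open ≡-Reasoning
  open import Algebra.Properties.CommutativeSemigroup +-commutativeSemigroup using (x∙yz≈y∙xz)

_without_ : ∀ {N} → (Fin N → Bool) → Fin N → Fin N → Bool
(p without i) j = p j ∧ not (does (j ≟ i))

without-self : ∀ {N} (p : Fin N → Bool) i → (p without i) i ≡ false
without-self p i rewrite dec-true (i ≟ i) refl = Bool.∧-zeroʳ (p i)

without-other : ∀ {N} (p : Fin N → Bool) {i j} → j ≢ i → (p without i) j ≡ p j
without-other p {i} {j} ne rewrite dec-false (j ≟ i) ne = Bool.∧-identityʳ (p j)

without⁻ : ∀ {N} (p : Fin N → Bool) {i j} → (p without i) j ≡ true → p j ≡ true × j ≢ i
without⁻ p {i} {j} h with j ≟ i
... | no  ne = trans (sym (Bool.∧-identityʳ (p j))) h , ne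
... | yes _  = true≢false h (Bool.∧-zeroʳ (p j))

cnt-without : ∀ {N} (p : Fin N → Bool) {i} → p i ≡ true → cnt p ≡ suc (cnt (p without i))
cnt-without p {i} pi = cnt-flip i pi (without-self p i) λ j ne → sym (without-other p ne)

cnt-two : ∀ {N} {p : Fin N → Bool} → 2 ≤ cnt p →
          ∃[ i ] ∃[ j ] (p i ≡ true × p j ≡ true × j ≢ i)
cnt-two {p = p} h =
  let i , pi = cnt-witness {p = p} (≤-trans (s≤s z≤n) h)
      j , pj = cnt-witness (s≤s⁻¹ (≤-trans h (≤-reflexive (cnt-without p pi))))
  in i , j , pi , without⁻ p pj

cnt-three : ∀ {N} {p : Fin N → Bool} → 3 ≤ cnt p →
            ∃[ i ] ∃[ j ] ∃[ k ] (p i ≡ true × p j ≡ true × p k ≡ true × j ≢ i × k ≢ i × k ≢ j)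
cnt-three {p = p} h =
  let i , pi = cnt-witness {p = p} (≤-trans (s≤s z≤n) h)
      j , k , pj , pk , ne = cnt-two (s≤s⁻¹ (≤-trans h (≤-reflexive (cnt-without p pi))))
      pj′ , ji = without⁻ p pj
      pk′ , ki = without⁻ p pk
  in i , j , k , pi , pj′ , pk′ , ji , ki , ne

cnt-injection : ∀ {a N} {q : Fin N → Bool} (g : Fin a → Fin N) →
                (∀ {i j} → g i ≡ g j → i ≡ j) → (∀ i → q (g i) ≡ true) → a ≤ cnt q
cnt-injection {zero}          g inj h = z≤n
cnt-injection {suc a} {q = q} g inj h = ≤-trans
  (s≤s (cnt-injection (g ∘ suc) (suc-injective ∘ inj)
    λ i → trans (without-other q (λ eq → case (inj eq))) (h (suc i))))
  (≤-reflexive (sym (cnt-without q (h zero))))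
  where
  case : ∀ {i : Fin a} → ¬ Fin.suc i ≡ zero
  case ()

-- A place in `q` but not in `p` would leave `p` inside `q without i`, which is too small.
-- `clique-elim` uses this to find every hub in a clique.
cnt-strict : ∀ {N} {p q : Fin N → Bool} → (∀ i → p i ≡ true → q i ≡ true) →
             cnt q ≤ cnt p → ∀ i → q i ≡ true → p i ≡ true
cnt-strict {p = p} {q} sub le i qi with p i in pi
... | true  = refl
... | false = ⊥-elim (1+n≰n (≤-trans (≤-reflexive (sym (cnt-without q qi)))
    (≤-trans le (cnt-mono λ j pj → trans (without-other q (λ eq → true≢false pj (trans (cong p eq) pi))) (sub j pj)))))

-- Subsets as Boolean predicates

∣tabulate∣ : ∀ {N} (p : Fin N → Bool) → ∣ tabulate p ∣ ≡ cnt p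
∣tabulate∣ {zero}  p = refl
∣tabulate∣ {suc N} p with p zero
... | true  = cong suc (∣tabulate∣ (p ∘ suc))
... | false = ∣tabulate∣ (p ∘ suc)

∣∣≡cnt : ∀ {N} (S : Subset N) → ∣ S ∣ ≡ cnt (lookup S)
∣∣≡cnt []          = refl
∣∣≡cnt (true  ∷ S) = cong suc (∣∣≡cnt S)
∣∣≡cnt (false ∷ S) = ∣∣≡cnt S

∈⇒ : ∀ {N} {S : Subset N} {i} → i ∈ₛ S → lookup S i ≡ true
∈⇒ = []=⇒lookup

⇒∈ : ∀ {N} {S : Subset N} {i} → lookup S i ≡ true → i ∈ₛ S
⇒∈ {S = S} {i} h = lookup⇒[]= i S h

⇒∈tab : ∀ {N} (p : Fin N → Bool) {i} → p i ≡ true → i ∈ₛ tabulate p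
⇒∈tab p {i} h = ⇒∈ (trans (lookup∘tabulate p i) h)

∈tab⇒ : ∀ {N} (p : Fin N → Bool) {i} → i ∈ₛ tabulate p → p i ≡ true
∈tab⇒ p {i} h = trans (sym (lookup∘tabulate p i)) (∈⇒ h)

shrink : ∀ {N} (p : Fin N → Bool) k → k ≤ cnt p →
         ∃[ q ] (cnt q ≡ k × (∀ i → q i ≡ true → p i ≡ true))
shrink {N} p zero h = (λ _ → false) , cnt-none {N} (λ _ → refl) , λ _ ()
shrink {suc N} p (suc k) h with p zero in eq
... | true  =
  let q , c , s = shrink (p ∘ suc) k (s≤s⁻¹ h)
  in (λ { zero → true ; (suc i) → q i }) , cong suc c , λ { zero _ → eq ; (suc i) e → s i e }
... | false =
  let q , c , s = shrink (p ∘ suc) (suc k) h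
  in (λ { zero → false ; (suc i) → q i }) , c , λ { (suc i) e → s i e }

-- Decision trees

-- Inputs are functions, of which a tree sees only the values; without function extensionality,
-- respect for pointwise equality has to be demanded.
Extensional : ∀ {N} → BoolFun N → Set
Extensional f = ∀ {x y} → (∀ i → x i ≡ y i) → f x → f y

-- Each query specialises `g` by one bit, so every branch has length `M`, even where the value is
-- settled earlier.
fullTree : ∀ {N} M → (Fin M → Fin N) → (Vec Bool M → Bool) → DTree N
fullTree zero    v g = leaf (g [])
fullTree (suc M) v g = node (v zero) (fullTree M (v ∘ suc) (g ∘ (false ∷_)))
                                     (fullTree M (v ∘ suc) (g ∘ (true ∷_)))

eval-fullTree : ∀ {N} M (v : Fin M → Fin N) g x → eval (fullTree M v g) x ≡ g (tabulate (x ∘ v))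
eval-fullTree zero    v g x = refl
eval-fullTree (suc M) v g x with x (v zero)
... | false = eval-fullTree M (v ∘ suc) _ x
... | true  = eval-fullTree M (v ∘ suc) _ x

depth-fullTree : ∀ {N} M (v : Fin M → Fin N) g → depth (fullTree M v g) ≡ M
depth-fullTree zero    v g = refl
depth-fullTree (suc M) v g
  rewrite depth-fullTree M (v ∘ suc) (g ∘ (false ∷_)) | depth-fullTree M (v ∘ suc) (g ∘ (true ∷_)) =
  cong suc (⊔-idem M)

cost≤depth : ∀ {N} (T : DTree N) x → cost T x ≤ depth T
cost≤depth (leaf b)       x = z≤n
cost≤depth (node i t₀ t₁) x with x i
... | false = s≤s (≤-trans (cost≤depth t₀ x) (m≤m⊔n _ _))
... | true  = s≤s (≤-trans (cost≤depth t₁ x) (m≤n⊔m _ _))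

computable : ∀ {N} (f : BoolFun N) → Extensional f → (∀ x → Dec (f x)) →
             ∃[ T ] (Computes f T × depth T ≡ N)
computable {N} f ext f? = T , computes , depth-fullTree N (λ i → i) g
  where
  g : Vec Bool N → Bool
  g v = does (f? (lookup v))
  T = fullTree N (λ i → i) g
  computes : Computes f T
  computes x = mk⇔
    (λ e → ext (lookup∘tabulate x)
             (does⇒ (f? (lookup (tabulate x))) (trans (sym (eval-fullTree N (λ i → i) g x)) e)))
    (λ fx → trans (eval-fullTree N (λ i → i) g x)
                  (dec-true (f? _) (ext (λ i → sym (lookup∘tabulate x i)) fx)))

-- If every certificate has size at least m, and every tree makes N queries on
-- some input with a certificate of size m, then the full tree is optimal.
module _ {N m : ℕ} {f : BoolFun N} (ext : Extensional f) (f? : ∀ x → Dec (f x))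
         (cert-≥ : ∀ x S → IsCert f x S → m ≤ ∣ S ∣)
         (hard : ∀ T → Computes f T → ∃[ x ] (N ≤ cost T x × ∃[ S ] (IsCert f x S × ∣ S ∣ ≤ m)))
  where

  private
    hardC : ∀ T → Computes f T → ∃[ x ] (N ≤ cost T x × IsC f x m)
    hardC T c = let x , le , S , cert , size = hard T c in
      x , le , (S , cert , ≤-antisym size (cert-≥ x S cert)) , cert-≥ x

    m≤C : ∀ x c → IsC f x c → m ≤ c
    m≤C x c ((S , cert , refl) , _) = cert-≥ x S cert

  evasive⇒IsDT : IsDT f N
  evasive⇒IsDT = computable f ext f? , λ T c →
    let x , le , _ = hardC T c in ≤-trans le (cost≤depth T x)

  -- The minimising input is the hard input for the full tree.
  evasive⇒IsCmin : IsCmin f m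
  evasive⇒IsCmin =
    let T , c , _ = computable f ext f?
        x , _ , isC = hardC T c
    in (x , isC) , m≤C

  -- The two sides of the ratio are bounded separately: the full tree costs at most `N` against
  -- certificates of size at least `m`, and a hard input costs at least `N` against certificate
  -- complexity exactly `m`.
  evasive⇒IsInstC : IsInstC f N m
  evasive⇒IsInstC =
    (let T , c , d = computable f ext f? in T , c , λ x c′ isC →
       *-mono-≤ (≤-trans (cost≤depth T x) (≤-reflexive d)) (m≤C x c′ isC)) ,
    λ T c → let x , le , isC = hardC T c in x , m , isC , *-monoˡ-≤ m le

-- Adversaries

Partial : ℕ → Set
Partial N = Fin N → Maybe Bool

-- Kept abstract so that the arguments of an update can be inferred.
abstract
  set : ∀ {N} {A : Set} → (Fin N → A) → Fin N → A → Fin N → A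
  set f i a j with j ≟ i
  ... | yes _ = a
  ... | no  _ = f j

  set-same : ∀ {N} {A : Set} (f : Fin N → A) i a → set f i a i ≡ a
  set-same f i a with i ≟ i
  ... | yes _ = refl
  ... | no ne = ⊥-elim (ne refl)

  set-other : ∀ {N} {A : Set} (f : Fin N → A) {i a j} → j ≢ i → set f i a j ≡ f j
  set-other f {i} {a} {j} ne with j ≟ i
  ... | yes eq = ⊥-elim (ne eq)
  ... | no _   = refl

set-cases : ∀ {N} {A : Set} (f : Fin N → A) {i a j b} → set f i a j ≡ b →
            (j ≡ i × a ≡ b) ⊎ (j ≢ i × f j ≡ b)
set-cases f {i} {a} {j} h with j ≟ i
... | yes refl = inj₁ (refl , trans (sym (set-same f i a)) h)
... | no ne    = inj₂ (ne , trans (sym (set-other f ne)) h)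

infixl 8 _[_↦_]
_[_↦_] : ∀ {N} → Partial N → Fin N → Bool → Partial N
ρ [ e ↦ b ] = set ρ e (just b)

update-same : ∀ {N} (ρ : Partial N) e b → (ρ [ e ↦ b ]) e ≡ just b
update-same ρ e b = set-same ρ e (just b)

update-other : ∀ {N} (ρ : Partial N) {e b j} → j ≢ e → (ρ [ e ↦ b ]) j ≡ ρ j
update-other ρ = set-other ρ

update-nothing : ∀ {N} (ρ : Partial N) {e b j} → (ρ [ e ↦ b ]) j ≡ nothing → j ≢ e × ρ j ≡ nothing
update-nothing ρ h with set-cases ρ h
... | inj₂ r = r

update-just : ∀ {N} (ρ : Partial N) {e b j c} → (ρ [ e ↦ b ]) j ≡ just c →
              (j ≡ e × b ≡ c) ⊎ (j ≢ e × ρ j ≡ just c)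
update-just ρ h with set-cases ρ h
... | inj₁ (eq , refl) = inj₁ (eq , refl)
... | inj₂ r           = inj₂ r

infix 4 _⊑_
_⊑_ : ∀ {N} → Partial N → (Fin N → Bool) → Set
ρ ⊑ x = ∀ j {b} → ρ j ≡ just b → x j ≡ b

⊑-update⁻ : ∀ {N} (ρ : Partial N) {e b x} → ρ e ≡ nothing → ρ [ e ↦ b ] ⊑ x → ρ ⊑ x
⊑-update⁻ ρ un sub j h = sub j (trans (update-other ρ λ { refl → nope (trans (sym un) h) }) h)
  where
  nope : ∀ {b : Bool} → ¬ nothing ≡ just b
  nope ()

⊑-at : ∀ {N} (ρ : Partial N) {e b x} → ρ [ e ↦ b ] ⊑ x → x e ≡ b
⊑-at ρ {e} {b} sub = sub e (update-same ρ e b)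

-- The default 0 makes the 1s of `fill ρ` exactly the 1-answers, so `cnt (fill ρ)` counts them.
fill : ∀ {N} → Partial N → Fin N → Bool
fill ρ i with ρ i
... | just b  = b
... | nothing = false

⊑-fill : ∀ {N} (ρ : Partial N) → ρ ⊑ fill ρ
⊑-fill ρ i h rewrite h = refl

isNothing? : (m : Maybe Bool) → Dec (m ≡ nothing)
isNothing? nothing  = yes refl
isNothing? (just _) = no λ ()

unqueried : ∀ {N} → Partial N → ℕ
unqueried ρ = cnt (λ i → does (isNothing? (ρ i)))

unqueried-update : ∀ {N} (ρ : Partial N) {e} b → ρ e ≡ nothing →
                   unqueried ρ ≡ suc (unqueried (ρ [ e ↦ b ]))
unqueried-update ρ {e} b un = cnt-flip e
  (cong (does ∘ isNothing?) un)
  (cong (does ∘ isNothing?) (update-same ρ e b))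
  λ j ne → cong (does ∘ isNothing?) (sym (update-other ρ ne))

-- The adversary keeps the position inside P; its last answer decides f, and
-- answering 1 there yields an input with property Q.
record Adversary {N} (f : BoolFun N) (Q : (Fin N → Bool) → Set) (P : Partial N → Set) : Set where
  field
    -- A position in `P` is never complete, so a play can end only through the second alternative of
    -- `answer`.
    live   : ∀ {ρ} → P ρ → ∃[ e ] ρ e ≡ nothing
    answer : ∀ {ρ e} → P ρ → ρ e ≡ nothing →
             (∃[ b ] P (ρ [ e ↦ b ])) ⊎
             ((∀ {j} → j ≢ e → ρ j ≢ nothing)
               × (∀ {x} → ρ [ e ↦ true ] ⊑ x → Q x)
               × (∀ {x} → ρ [ e ↦ false ] ⊑ x → ¬ f x))

module _ {N} {f : BoolFun N} {Q P} (Q⇒f : ∀ {x} → Q x → f x) (adv : Adversary f Q P) where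
  open Adversary adv

  private
    -- The adversary queries itself until the deciding variable comes up, whose two answers yield
    -- completions with different values. A tree that stops inside `P` thus errs on one of them.
    undetermined : ∀ u {ρ} → unqueried ρ ≡ u → P ρ →
                   (∃[ x ] (ρ ⊑ x × f x)) × (∃[ x ] (ρ ⊑ x × ¬ f x))
    undetermined u {ρ} eq p with live p
    ... | e , un with answer p un
    undetermined zero {ρ} eq p | e , un | inj₁ (b , p′) with trans (sym eq) (unqueried-update ρ b un)
    ... | ()
    undetermined (suc u) {ρ} eq p | e , un | inj₁ (b , p′) =
      let (x , sx , fx) , (y , sy , fy) =
            undetermined u (Data.Nat.Properties.suc-injective (trans (sym (unqueried-update ρ b un)) eq)) p′
      in (x , ⊑-update⁻ ρ un sx , fx) , (y , ⊑-update⁻ ρ un sy , fy)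
    undetermined u {ρ} eq p | e , un | inj₂ (_ , h₁ , h₀) =
      (_ , ⊑-update⁻ ρ un (⊑-fill (ρ [ e ↦ true ])) , Q⇒f (h₁ (⊑-fill (ρ [ e ↦ true ])))) ,
      (_ , ⊑-update⁻ ρ un (⊑-fill (ρ [ e ↦ false ])) , h₀ (⊑-fill (ρ [ e ↦ false ])))

    cost-at : ∀ {i t₀ t₁ x b} → x i ≡ b → cost {N} (node i t₀ t₁) x ≡ suc (cost (if b then t₁ else t₀) x)
    cost-at {i} {x = x} h with x i
    cost-at refl | false = refl
    cost-at refl | true  = refl

    eval-at : ∀ {i t₀ t₁ x b} → x i ≡ b → eval {N} (node i t₀ t₁) x ≡ eval (if b then t₁ else t₀) x
    eval-at {i} {x = x} h with x i
    eval-at refl | false = refl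
    eval-at refl | true  = refl

    bothBranches : ∀ {i t₀ t₁} {ρ : Partial N} b → (∀ x → ρ ⊑ x → (eval (node i t₀ t₁) x ≡ true) ⇔ f x) →
                   (∀ {x} → ρ ⊑ x → x i ≡ b) →
                   ∀ x → ρ ⊑ x → (eval (if b then t₁ else t₀) x ≡ true) ⇔ f x
    bothBranches b c q x s = mk⇔
      (λ e → Equivalence.to (c x s) (trans (eval-at (q s)) e))
      (λ fx → trans (sym (eval-at (q s))) (Equivalence.from (c x s) fx))

  -- A fresh query costs one and uses up one unqueried variable; a repeated query follows the
  -- recorded answer and only adds cost; a leaf contradicts `undetermined`. Correctness is assumed
  -- only for inputs extending `ρ`, since a subtree promises no more.
  adversary-cost : ∀ T {ρ} → P ρ → (∀ x → ρ ⊑ x → (eval T x ≡ true) ⇔ f x) →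
                   ∃[ x ] (ρ ⊑ x × Q x × unqueried ρ ≤ cost T x)
  adversary-cost (leaf b) p c =
    let (x , sx , fx) , (y , sy , fy) = undetermined _ refl p
    in ⊥-elim (fy (Equivalence.to (c y sy) (Equivalence.from (c x sx) fx)))
  adversary-cost (node i t₀ t₁) {ρ} p c with ρ i in eq
  ... | just b =
    let x , s , q , le = go b p (bothBranches b c λ s → s i eq)
    in x , s , q , ≤-trans (m≤n⇒m≤1+n le) (≤-reflexive (sym (cost-at (s i eq))))
    where
    go : ∀ b {ρ} → P ρ → (∀ x → ρ ⊑ x → (eval (if b then t₁ else t₀) x ≡ true) ⇔ f x) →
         ∃[ x ] (ρ ⊑ x × Q x × unqueried ρ ≤ cost (if b then t₁ else t₀) x)
    go true  = adversary-cost t₁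
    go false = adversary-cost t₀
  ... | nothing with answer p eq
  ...   | inj₁ (b , p′) =
    let x , s , q , le = go b p′ (bothBranches b (λ x s → c x (⊑-update⁻ ρ eq s)) (⊑-at ρ))
    in x , ⊑-update⁻ ρ eq s , q ,
       ≤-trans (≤-reflexive (unqueried-update ρ b eq))
         (≤-trans (s≤s le) (≤-reflexive (sym (cost-at (⊑-at ρ s)))))
    where
    go : ∀ b {ρ} → P ρ → (∀ x → ρ ⊑ x → (eval (if b then t₁ else t₀) x ≡ true) ⇔ f x) →
         ∃[ x ] (ρ ⊑ x × Q x × unqueried ρ ≤ cost (if b then t₁ else t₀) x)
    go true  = adversary-cost t₁
    go false = adversary-cost t₀
  -- Exactly one variable was unqueried, so the present query already pays the bound, whatever the
  -- chosen subtree does.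
  ...   | inj₂ (last , h₁ , _) =
    let s = ⊑-fill (ρ [ i ↦ true ])
    in fill (ρ [ i ↦ true ]) , ⊑-update⁻ ρ eq s , h₁ s ,
       ≤-trans (≤-reflexive (trans (unqueried-update ρ true eq) (cong suc (cnt-none {N} λ j → dec-false (isNothing? ((ρ [ i ↦ true ]) j))
                 λ un → let ne , un′ = update-nothing ρ {i} {true} {j} un in last ne un′))))
         (≤-trans (s≤s z≤n) (≤-reflexive (sym (cost-at {i} {t₀} {t₁} {fill (ρ [ i ↦ true ])} (⊑-at ρ s)))))

  adversary-hard : P (λ _ → nothing) → ∀ T → Computes f T → ∃[ x ] (Q x × N ≤ cost T x)
  adversary-hard p T c =
    let x , _ , q , le = adversary-cost T p λ x _ → c x
    in x , q , ≤-trans (≤-reflexive (sym (cnt-all {N} λ _ → refl))) le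

-- Edges

ends : ∀ n → Fin (E n) → Fin n × Fin n
ends n e = lookup (pairs n) e

Joins : ∀ {n} → Fin (E n) → Fin n → Fin n → Set
Joins {n} e u v = ends n e ≡ (u , v) ⊎ ends n e ≡ (v , u)

joins? : ∀ {n} (e : Fin (E n)) (u v : Fin n) → Dec (Joins e u v)
joins? {n} e u v = ≡-dec _≟_ _≟_ (ends n e) (u , v) ⊎-dec ≡-dec _≟_ _≟_ (ends n e) (v , u)

joins-ends : ∀ {n} (e : Fin (E n)) → Joins e (proj₁ (ends n e)) (proj₂ (ends n e))
joins-ends e = inj₁ refl

joins-sym : ∀ {n} {e : Fin (E n)} {u v : Fin n} → Joins e u v → Joins e v u
joins-sym = swap

joins-same : ∀ {n} {e : Fin (E n)} {u v u′ v′ : Fin n} → Joins e u v → Joins e u′ v′ →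
             (u ≡ u′ × v ≡ v′) ⊎ (u ≡ v′ × v ≡ u′)
joins-same (inj₁ p) (inj₁ q) = inj₁ (,-injective (trans (sym p) q))
joins-same (inj₁ p) (inj₂ q) = inj₂ (,-injective (trans (sym p) q))
joins-same (inj₂ p) (inj₁ q) = let a , b = ,-injective (trans (sym p) q) in inj₂ (b , a)
joins-same (inj₂ p) (inj₂ q) = let a , b = ,-injective (trans (sym p) q) in inj₁ (b , a)

-- Follows the recursion of `pairs`: the first `n` variables join the newest vertex `fromℕ n` to the
-- older ones, the others enumerate the smaller graph.
data EdgeView {n} : Fin (E (suc n)) → Set where
  star : ∀ i → EdgeView (i ↑ˡ E n)
  oldEdge  : ∀ e → EdgeView (n ↑ʳ e)

edgeView : ∀ {n} (e : Fin (E (suc n))) → EdgeView e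
edgeView {n} e with splitAt n e in eq
... | inj₁ i  = subst EdgeView (splitAt⁻¹-↑ˡ eq) (star i)
... | inj₂ e′ = subst EdgeView (splitAt⁻¹-↑ʳ eq) (oldEdge e′)

ends-star : ∀ n i → ends (suc n) (i ↑ˡ E n) ≡ (inject₁ i , fromℕ n)
ends-star n i = trans (lookup-++ˡ (tabulate (λ i → inject₁ i , fromℕ n)) _ i) (lookup∘tabulate _ i)

ends-old : ∀ n e → ends (suc n) (n ↑ʳ e) ≡ (inject₁ (proj₁ (ends n e)) , inject₁ (proj₂ (ends n e)))
ends-old n e = trans (lookup-++ʳ (tabulate (λ i → inject₁ i , fromℕ n)) _ e) (lookup-map e _ (pairs n))

ends-ordered : ∀ n e → toℕ (proj₁ (ends n e)) < toℕ (proj₂ (ends n e))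
ends-ordered (suc n) e with edgeView {n} e
... | star i rewrite ends-star n i | toℕ-inject₁ i | toℕ-fromℕ n = toℕ<n i
... | oldEdge e′ rewrite ends-old n e′ | toℕ-inject₁ (proj₁ (ends n e′)) | toℕ-inject₁ (proj₂ (ends n e′)) =
  ends-ordered n e′

ends-injective : ∀ n {e e′} → ends n e ≡ ends n e′ → e ≡ e′
ends-injective (suc n) {e} {e′} h with edgeView {n} e | edgeView {n} e′
... | star i | star j rewrite ends-star n i | ends-star n j =
  cong (_↑ˡ E n) (inject₁-injective (proj₁ (,-injective h)))
... | star i | oldEdge e₂ rewrite ends-star n i | ends-old n e₂ =
  ⊥-elim (fromℕ≢inject₁ (proj₂ (,-injective h)))
... | oldEdge e₁ | star j rewrite ends-old n e₁ | ends-star n j =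
  ⊥-elim (fromℕ≢inject₁ (sym (proj₂ (,-injective h))))
... | oldEdge e₁ | oldEdge e₂ rewrite ends-old n e₁ | ends-old n e₂ =
  let a , b = ,-injective h
  in cong (n ↑ʳ_) (ends-injective n (cong₂ _,_ (inject₁-injective a) (inject₁-injective b)))

joins-irrefl : ∀ {n} {e : Fin (E n)} {u v : Fin n} → Joins e u v → u ≢ v
joins-irrefl {n} {e} (inj₁ p) refl with ends-ordered n e
... | lt rewrite p = <-irrefl refl lt
joins-irrefl {n} {e} (inj₂ p) refl with ends-ordered n e
... | lt rewrite p = <-irrefl refl lt

-- Opposite orientations cannot both be listed, as `ends-ordered` puts the smaller vertex first.
joins-unique : ∀ {n} {e e′ : Fin (E n)} {u v : Fin n} → Joins e u v → Joins e′ u v → e ≡ e′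
joins-unique {n} (inj₁ p) (inj₁ q) = ends-injective n (trans p (sym q))
joins-unique {n} (inj₂ p) (inj₂ q) = ends-injective n (trans p (sym q))
joins-unique {n} {e} {e′} (inj₁ p) (inj₂ q) with ends-ordered n e | ends-ordered n e′
... | a | b rewrite p | q = ⊥-elim (<-asym a b)
joins-unique {n} {e} {e′} (inj₂ p) (inj₁ q) with ends-ordered n e | ends-ordered n e′
... | a | b rewrite p | q = ⊥-elim (<-asym a b)

edge-between : ∀ {n} {u v : Fin n} → u ≢ v → ∃[ e ] Joins e u v
edge-between {suc n} {u} {v} ne with view u | view v
... | ‵fromℕ | ‵fromℕ = ⊥-elim (ne refl)
... | ‵fromℕ | ‵inject₁ j = j ↑ˡ E n , inj₂ (ends-star n j)
... | ‵inject₁ i | ‵fromℕ = i ↑ˡ E n , inj₁ (ends-star n i)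
... | ‵inject₁ i | ‵inject₁ j with edge-between {n} {i} {j} (ne ∘ cong inject₁)
...   | e , inj₁ p = n ↑ʳ e , inj₁ (trans (ends-old n e) (cong (λ (a , b) → inject₁ a , inject₁ b) p))
...   | e , inj₂ p = n ↑ʳ e , inj₂ (trans (ends-old n e) (cong (λ (a , b) → inject₁ a , inject₁ b) p))

cnt-++ : ∀ a {b} (p : Fin (a + b) → Bool) → cnt p ≡ cnt (λ i → p (i ↑ˡ b)) + cnt (λ i → p (a ↑ʳ i))
cnt-++ zero    p = refl
cnt-++ (suc a) p = trans (cong (bit (p zero) +_) (cnt-++ a (p ∘ suc))) (sym (+-assoc (bit (p zero)) _ _))

inside : ∀ {n} → (Fin n → Bool) → Fin (E n) → Bool
inside {n} p e = p (proj₁ (ends n e)) ∧ p (proj₂ (ends n e))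

inside⇒ : ∀ {n} {p : Fin n → Bool} {e} {u v : Fin n} → Joins e u v → inside p e ≡ true → p u ≡ true × p v ≡ true
inside⇒ {n} {p} {e} j h with Bool.∧-conicalˡ (p (proj₁ (ends n e))) _ h | Bool.∧-conicalʳ (p (proj₁ (ends n e))) _ h
inside⇒ {n} {p} {e} (inj₁ q) h | a | b rewrite q = a , b
inside⇒ {n} {p} {e} (inj₂ q) h | a | b rewrite q = b , a

⇒inside : ∀ {n} {p : Fin n → Bool} {e} {u v : Fin n} → Joins e u v → p u ≡ true → p v ≡ true → inside p e ≡ true
⇒inside (inj₁ q) a b rewrite q | a | b = refl
⇒inside (inj₂ q) a b rewrite q | a | b = refl

-- Induction on the vertices: the last one, if it is in `p`, contributes one edge for each earlier
-- vertex of `p`, which is the recursion of `E`.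
cnt-inside : ∀ {n} (p : Fin n → Bool) → cnt (inside p) ≡ E (cnt p)
cnt-inside {zero}  p = refl
cnt-inside {suc n} p = begin
  cnt (inside p)
    ≡⟨ cnt-++ n (inside p) ⟩
  cnt (λ i → inside p (i ↑ˡ E n)) + cnt (λ e → inside p (n ↑ʳ e))
    ≡⟨ cong₂ _+_ (cnt-cong λ i → cong (λ (a , b) → p a ∧ p b) (ends-star n i))
                 (cnt-cong λ e → cong (λ (a , b) → p a ∧ p b) (ends-old n e)) ⟩
  cnt (λ i → p (inject₁ i) ∧ p (fromℕ n)) + cnt (inside (p ∘ inject₁))
    ≡⟨ cong (cnt (λ i → p (inject₁ i) ∧ p (fromℕ n)) +_) (cnt-inside (p ∘ inject₁)) ⟩
  cnt (λ i → p (inject₁ i) ∧ p (fromℕ n)) + E (cnt (p ∘ inject₁))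
    ≡⟨ last (p (fromℕ n)) ⟩
  E (bit (p (fromℕ n)) + cnt (p ∘ inject₁))
    ≡⟨ cong E (cnt-last p) ⟨
  E (cnt p) ∎
  where
  open ≡-Reasoning
  last : ∀ b → cnt (λ i → p (inject₁ i) ∧ b) + E (cnt (p ∘ inject₁)) ≡ E (bit b + cnt (p ∘ inject₁))
  last true  = cong (_+ E (cnt (p ∘ inject₁))) (cnt-cong λ i → Bool.∧-identityʳ (p (inject₁ i)))
  last false = cong (_+ E (cnt (p ∘ inject₁))) (cnt-none {n} λ i → Bool.∧-zeroʳ (p (inject₁ i)))

-- A Turán-type bound

_∷ʳ_ : ∀ {A : Set} {n} → (Fin n → A) → A → Fin (suc n) → A
(f ∷ʳ a) i with view i
... | ‵fromℕ     = a
... | ‵inject₁ j = f j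

∷ʳ-last : ∀ {A : Set} {n} (f : Fin n → A) a → (f ∷ʳ a) (fromℕ n) ≡ a
∷ʳ-last {n = n} f a rewrite view-fromℕ n = refl

∷ʳ-init : ∀ {A : Set} {n} (f : Fin n → A) a j → (f ∷ʳ a) (inject₁ j) ≡ f j
∷ʳ-init f a j rewrite view-inject₁ j = refl

-- Greedy colouring with colours 0, …, D-1; a vertex receives the overflow
-- colour D only if it has an earlier neighbour in each of the D classes.
greedyColouring : ∀ D {n} (S : Fin (E n) → Bool) → Σ (Fin n → ℕ) λ c →
  ((∀ v → c v ≤ D)
   × (∀ e → S e ≡ true → c (proj₁ (ends n e)) ≡ c (proj₂ (ends n e)) → c (proj₁ (ends n e)) ≡ D)
   × D * cnt (λ v → does (c v ℕ.≟ D)) ≤ cnt S)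
greedyColouring D {zero}  S = (λ ()) , (λ ()) , (λ ()) , ≤-reflexive (*-zeroʳ D)
greedyColouring D {suc n} S
  with greedyColouring D {n} (λ e → S (n ↑ʳ e))
     | any? (λ (d : Fin D) → ¬? (any? λ i →
         (S (i ↑ˡ E n) Bool.≟ true) ×-dec (proj₁ (greedyColouring D {n} (λ e → S (n ↑ʳ e))) i ℕ.≟ toℕ d)))
... | c , c≤ , proper , few | yes (d , free) = c ∷ʳ toℕ d , bound , proper′ , few′
  where
  bound : ∀ v → (c ∷ʳ toℕ d) v ≤ D
  bound v with view v
  ... | ‵fromℕ     = <⇒≤ (toℕ<n d)
  ... | ‵inject₁ j = c≤ j
  proper′ : ∀ e → S e ≡ true → (c ∷ʳ toℕ d) (proj₁ (ends (suc n) e)) ≡ (c ∷ʳ toℕ d) (proj₂ (ends (suc n) e)) →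
            (c ∷ʳ toℕ d) (proj₁ (ends (suc n) e)) ≡ D
  proper′ e s eq with edgeView {n} e
  ... | star i rewrite ends-star n i | ∷ʳ-last c (toℕ d) | ∷ʳ-init c (toℕ d) i = ⊥-elim (free (i , s , eq))
  ... | oldEdge e′ rewrite ends-old n e′ | ∷ʳ-init c (toℕ d) (proj₁ (ends n e′)) | ∷ʳ-init c (toℕ d) (proj₂ (ends n e′)) =
    proper e′ s eq
  few′ : D * cnt (λ v → does ((c ∷ʳ toℕ d) v ℕ.≟ D)) ≤ cnt S
  few′ = begin
    D * cnt (λ v → does ((c ∷ʳ toℕ d) v ℕ.≟ D))
      ≡⟨ cong (D *_) (trans (cnt-last (λ v → does ((c ∷ʳ toℕ d) v ℕ.≟ D))) (cong₂ _+_
           (cong bit (dec-false (_ ℕ.≟ D) λ q → <⇒≢ (toℕ<n d) (trans (sym (∷ʳ-last c (toℕ d))) q)))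
           (cnt-cong λ j → cong (λ z → does (z ℕ.≟ D)) (∷ʳ-init c (toℕ d) j)))) ⟩
    D * cnt (λ v → does (c v ℕ.≟ D)) ≤⟨ few ⟩
    cnt (λ e → S (n ↑ʳ e))           ≤⟨ m≤n+m _ _ ⟩
    cnt (λ i → S (i ↑ˡ E n)) + cnt (λ e → S (n ↑ʳ e)) ≡⟨ cnt-++ n S ⟨
    cnt S ∎
    where open ≤-Reasoning
... | c , c≤ , proper , few | no allHit = c ∷ʳ D , bound , proper′ , few′
  where
  hit : ∀ d → ∃[ i ] (S (i ↑ˡ E n) ≡ true × c i ≡ toℕ d)
  hit d with any? (λ i → (S (i ↑ˡ E n) Bool.≟ true) ×-dec (c i ℕ.≟ toℕ d))
  ... | yes h  = h
  ... | no  ¬h = ⊥-elim (allHit (d , ¬h))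
  bound : ∀ v → (c ∷ʳ D) v ≤ D
  bound v with view v
  ... | ‵fromℕ     = ≤-refl
  ... | ‵inject₁ j = c≤ j
  proper′ : ∀ e → S e ≡ true → (c ∷ʳ D) (proj₁ (ends (suc n) e)) ≡ (c ∷ʳ D) (proj₂ (ends (suc n) e)) →
            (c ∷ʳ D) (proj₁ (ends (suc n) e)) ≡ D
  proper′ e s eq with edgeView {n} e
  ... | star i rewrite ends-star n i | ∷ʳ-last c D | ∷ʳ-init c D i = eq
  ... | oldEdge e′ rewrite ends-old n e′ | ∷ʳ-init c D (proj₁ (ends n e′)) | ∷ʳ-init c D (proj₂ (ends n e′)) =
    proper e′ s eq
  few′ : D * cnt (λ v → does ((c ∷ʳ D) v ℕ.≟ D)) ≤ cnt S
  few′ = begin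
    D * cnt (λ v → does ((c ∷ʳ D) v ℕ.≟ D))
      ≡⟨ cong (D *_) (trans (cnt-last (λ v → does ((c ∷ʳ D) v ℕ.≟ D))) (cong₂ _+_
           (cong bit (dec-true (_ ℕ.≟ D) (∷ʳ-last c D)))
           (cnt-cong λ j → cong (λ z → does (z ℕ.≟ D)) (∷ʳ-init c D j)))) ⟩
    D * suc (cnt (λ v → does (c v ℕ.≟ D)))  ≡⟨ *-suc D _ ⟩
    D + D * cnt (λ v → does (c v ℕ.≟ D))
      -- Neighbours of different colours are different vertices, so the new overflow vertex pays for
      -- itself with `D` star edges.
      ≤⟨ +-mono-≤ (cnt-injection (proj₁ ∘ hit)
           (λ {d} {d′} eq → toℕ-injective (trans (sym (proj₂ (proj₂ (hit d))))
             (trans (cong c eq) (proj₂ (proj₂ (hit d′))))))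
           (λ d → proj₁ (proj₂ (hit d)))) few ⟩
    cnt (λ i → S (i ↑ˡ E n)) + cnt (λ e → S (n ↑ʳ e)) ≡⟨ cnt-++ n S ⟨
    cnt S ∎
    where open ≤-Reasoning

classes-cover : ∀ {n} (c : Fin n → ℕ) D b → (∀ d → d < D → cnt (λ v → does (c v ℕ.≟ d)) ≤ b) →
                cnt (λ v → does (c v <? D)) ≤ D * b
classes-cover {n} c zero b h = ≤-reflexive (cnt-none {n} λ i → dec-false (c i <? 0) λ ())
classes-cover c (suc D) b h = begin
  cnt (λ v → does (c v <? suc D))
    ≡⟨ cnt-split _ (λ v → does (c v ℕ.≟ D)) ⟩
  cnt (λ v → does (c v <? suc D) ∧ does (c v ℕ.≟ D)) + cnt (λ v → does (c v <? suc D) ∧ not (does (c v ℕ.≟ D)))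
    ≤⟨ +-mono-≤ (cnt-mono λ v → Bool.∧-conicalʳ (does (c v <? suc D)) _) (cnt-mono below) ⟩
  cnt (λ v → does (c v ℕ.≟ D)) + cnt (λ v → does (c v <? D))
    ≤⟨ +-mono-≤ (h D ≤-refl) (classes-cover c D b λ d lt → h d (m≤n⇒m≤1+n lt)) ⟩
  b + D * b ∎
  where
  open ≤-Reasoning
  below : ∀ v → does (c v <? suc D) ∧ not (does (c v ℕ.≟ D)) ≡ true → does (c v <? D) ≡ true
  below v e = dec-true (c v <? D) (≤∧≢⇒<
    (s≤s⁻¹ (does⇒ (c v <? suc D) (Bool.∧-conicalˡ _ _ e)))
    (λ eq → true≢false (Bool.∧-conicalʳ (does (c v <? suc D)) _ e) (cong not (dec-true (c v ℕ.≟ D) eq))))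


-- Working with `k * k` gives away about a factor 2, which affects only the constant.
E≤square : ∀ k → E k ≤ k * k
E≤square zero    = z≤n
E≤square (suc k) = ≤-trans (+-monoʳ-≤ k (E≤square k))
  (m≤n⇒m≤1+n (+-monoʳ-≤ k (*-monoʳ-≤ k (n≤1+n k))))

-- With D = ⌊n / 2k⌋ colours, classes of size at most k leave at least n / 2
-- overflow vertices, each accounting for D ≥ n / 4k edges.
turán-arithmetic : ∀ n k o s .{{_ : ℕ.NonZero k}} .{{_ : ℕ.NonZero (2 * k)}} → k ^ 3 * 2 ^ 3 ≤ n ^ 2 →
  n / (2 * k) * o ≤ s → n ≤ o + n / (2 * k) * k → k * k ≤ s
turán-arithmetic n k o s big few cover =
  *-cancelʳ-≤ (k * k) s (8 * k) {{m*n≢0 8 k}} (begin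
    k * k * (8 * k)       ≡⟨ solve 1 (λ k → k :* k :* (con 8 :* k) := (k :* (k :* (k :* con 1))) :* con 8) refl k ⟩
    k ^ 3 * 2 ^ 3         ≤⟨ big ⟩
    n ^ 2                 ≡⟨ cong (n *_) (*-identityʳ n) ⟩
    n * n                 ≤⟨ *-mono-≤ n≤4kD n≤2o ⟩
    4 * k * D * (2 * o) ≡⟨ solve 3 (λ k d o → con 4 :* k :* d :* (con 2 :* o) := d :* o :* (con 8 :* k)) refl k D (o) ⟩
    D * o * (8 * k)     ≤⟨ *-monoˡ-≤ (8 * k) few ⟩
    s * (8 * k)           ∎)
  where
  open ≤-Reasoning
  open +-*-Solver
  D = n / (2 * k)
  D2k≤n : D * (2 * k) ≤ n
  D2k≤n = m/n*n≤m n (2 * k)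
  n≤2o : n ≤ 2 * o
  n≤2o = +-cancelʳ-≤ n n (2 * o) (begin
    n + n               ≡⟨ cong (n +_) (+-identityʳ n) ⟨
    2 * n               ≤⟨ *-monoʳ-≤ 2 cover ⟩
    2 * (o + D * k)   ≡⟨ solve 3 (λ k d o → con 2 :* (o :+ d :* k) := con 2 :* o :+ d :* (con 2 :* k)) refl k D (o) ⟩
    2 * o + D * (2 * k) ≤⟨ +-monoʳ-≤ (2 * o) D2k≤n ⟩
    2 * o + n         ∎)
  -- This makes `D` at least 1, so the remainder of the division is at most `D * (2 * k)` and
  -- rounding loses no more than a factor 2.
  2k≤n : 2 * k ≤ n
  2k≤n = ≮⇒≥ λ n<2k → <-irrefl refl (begin-strict
    n ^ 2                 ≡⟨ cong (n *_) (*-identityʳ n) ⟩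
    n * n                 <⟨ *-mono-< n<2k n<2k ⟩
    2 * k * (2 * k)       ≡⟨ solve 1 (λ k → con 2 :* k :* (con 2 :* k) := k :* k :* con 4) refl k ⟩
    k * k * 4             ≤⟨ *-monoʳ-≤ (k * k) (≤-trans (m≤m+n 4 4) (m≤n*m 8 k)) ⟩
    k * k * (k * 8)       ≡⟨ solve 1 (λ k → k :* k :* (k :* con 8) := (k :* (k :* (k :* con 1))) :* con 8) refl k ⟩
    k ^ 3 * 2 ^ 3         ≤⟨ big ⟩
    n ^ 2                 ∎)
  n≤4kD : n ≤ 4 * k * D
  n≤4kD = begin
    n                             ≡⟨ m≡m%n+[m/n]*n n (2 * k) ⟩
    n % (2 * k) + D * (2 * k)     ≤⟨ +-monoˡ-≤ (D * (2 * k)) (m%n≤n n (2 * k)) ⟩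
    2 * k + D * (2 * k)           ≤⟨ +-monoˡ-≤ (D * (2 * k)) (≤-trans (≤-reflexive (sym (*-identityˡ (2 * k)))) (*-monoˡ-≤ (2 * k) (m≥n⇒m/n>0 2k≤n))) ⟩
    D * (2 * k) + D * (2 * k)     ≡⟨ solve 2 (λ k d → d :* (con 2 :* k) :+ d :* (con 2 :* k) := con 4 :* k :* d) refl k D ⟩
    4 * k * D                     ∎

-- A class of proper colour is independent in `S`, so `K` can be cut out of one with at least `k`
-- vertices; if all are smaller, the overflow vertices force `k * k` edges.
turán : ∀ n k (S : Fin (E n) → Bool) .{{_ : ℕ.NonZero k}} .{{_ : ℕ.NonZero (2 * k)}} →
        k ^ 3 * 2 ^ 3 ≤ n ^ 2 → cnt S < k * k →
        Σ (Fin n → Bool) λ K → cnt K ≡ k × (∀ e → S e ≡ true → inside K e ≡ true → ⊥)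
turán n k S big small
  with greedyColouring (n / (2 * k)) {n} S
... | c , c≤ , proper , few
  with any? (λ (d : Fin (n / (2 * k))) → k ≤? cnt (λ v → does (c v ℕ.≟ toℕ d)))
... | yes (d , large) = K , size , independent
  where
  class = shrink (λ v → does (c v ℕ.≟ toℕ d)) k large
  K = proj₁ class
  size = proj₁ (proj₂ class)
  coloured : ∀ v → K v ≡ true → c v ≡ toℕ d
  coloured v h = does⇒ (c v ℕ.≟ toℕ d) (proj₂ (proj₂ class) v h)
  independent : ∀ e → S e ≡ true → inside K e ≡ true → ⊥
  independent e s h =
    let a , b = inside⇒ {n} {K} {e} (joins-ends e) h
        ca = coloured _ a
        cb = coloured _ b
    in <⇒≢ (toℕ<n d) (trans (sym ca) (proper e s (trans ca (sym cb))))
... | no none = ⊥-elim (<⇒≱ small (turán-arithmetic n k _ (cnt S) big few (begin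
  n                                   ≡⟨ cnt-all {n} (λ _ → refl) ⟨
  cnt {n} (λ _ → true)                ≡⟨ cnt-split {n} (λ _ → true) (λ v → does (c v ℕ.≟ D)) ⟩
  cnt (λ v → does (c v ℕ.≟ D)) + cnt (λ v → not (does (c v ℕ.≟ D)))
    ≤⟨ +-monoʳ-≤ (cnt (λ v → does (c v ℕ.≟ D))) (≤-trans (cnt-mono proper-colour) (classes-cover c D k smallClass)) ⟩
  cnt (λ v → does (c v ℕ.≟ D)) + D * k ∎)))
  where
  open ≤-Reasoning
  D = n / (2 * k)
  proper-colour : ∀ v → not (does (c v ℕ.≟ D)) ≡ true → does (c v <? D) ≡ true
  proper-colour v h = dec-true (c v <? D)
    (≤∧≢⇒< (c≤ v) λ eq → true≢false h (cong not (dec-true (c v ℕ.≟ D) eq)))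
  smallClass : ∀ d → d < D → cnt (λ v → does (c v ℕ.≟ d)) ≤ k
  smallClass d lt = <⇒≤ (≰⇒> λ large → none (fromℕ< lt ,
    subst (λ d → k ≤ cnt (λ v → does (c v ℕ.≟ d))) (sym (toℕ-fromℕ< lt)) large))

-- Connectivity

-- The merging of two components on the level of labels: `a` and `b` become one label and all others
-- stay apart.
record Collapse {r} (a b : Fin (suc r)) : Set where
  field
    π        : Fin (suc r) → Fin r
    glues    : π a ≡ π b
    only     : ∀ {x y} → π x ≡ π y → x ≡ y ⊎ ((x ≡ a × y ≡ b) ⊎ (x ≡ b × y ≡ a))
    section  : Fin r → Fin (suc r)
    π∘section : ∀ z → π (section z) ≡ z

collapse : ∀ {r} {a b : Fin (suc r)} → a ≢ b → Collapse a b
collapse {r} {a} {b} a≢b = record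
  { π = π ; glues = trans (π-other a≢b) (sym π-self) ; only = only
  ; section = punchIn b ; π∘section = λ z → trans (π-other (punchInᵢ≢i b z)) (punchOut-punchIn b) }
  where
  π : Fin (suc r) → Fin r
  π x with x ≟ b
  ... | yes _  = punchOut (≢-sym a≢b)
  ... | no x≢b = punchOut (≢-sym x≢b)
  π-self : π b ≡ punchOut (≢-sym a≢b)
  π-self with b ≟ b
  ... | yes _ = refl
  ... | no ne = ⊥-elim (ne refl)
  π-other : ∀ {x} (ne : x ≢ b) → π x ≡ punchOut (≢-sym ne)
  π-other {x} ne with x ≟ b
  ... | yes eq = ⊥-elim (ne eq)
  ... | no _   = punchOut-cong b refl
  only : ∀ {x y} → π x ≡ π y → x ≡ y ⊎ ((x ≡ a × y ≡ b) ⊎ (x ≡ b × y ≡ a))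
  only {x} {y} eq with x ≟ b | y ≟ b
  ... | yes p | yes q = inj₁ (trans p (sym q))
  ... | yes p | no q  = inj₂ (inj₂ (p , sym (punchOut-injective (≢-sym a≢b) (≢-sym q) eq)))
  ... | no p  | yes q = inj₂ (inj₁ (punchOut-injective (≢-sym p) (≢-sym a≢b) eq , q))
  ... | no p  | no q  = inj₁ (punchOut-injective (≢-sym p) (≢-sym q) eq)

-- Edges are added one at a time, so the edge list `end` is arbitrary and reachability in the final
-- graph appears as a fixed relation. `enough` holds because each 1-edge removes at most one label.
record Components {N n} (end : Fin N → Fin n × Fin n) (x : Fin N → Bool) (_~_ : Fin n → Fin n → Set) : Set where
  field
    r      : ℕ
    ℓ      : Fin n → Fin r
    rep    : Fin r → Fin n
    ℓ∘rep  : ∀ z → ℓ (rep z) ≡ z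
    respect : ∀ e → x e ≡ true → ℓ (proj₁ (end e)) ≡ ℓ (proj₂ (end e))
    linked : ∀ {i j} → ℓ i ≡ ℓ j → i ~ j
    enough : n ≤ r + cnt x

components : ∀ {N n} (end : Fin N → Fin n × Fin n) x (_~_ : Fin n → Fin n → Set) →
             (∀ {i} → i ~ i) → (∀ {i j} → i ~ j → j ~ i) → (∀ {i j k} → i ~ j → j ~ k → i ~ k) →
             (∀ e → x e ≡ true → proj₁ (end e) ~ proj₂ (end e)) → Components end x _~_
components {zero} {n} end x _~_ rfl sy tr edge = record
  { r = n ; ℓ = λ i → i ; rep = λ i → i ; ℓ∘rep = λ _ → refl ; respect = λ () ; linked = λ { refl → rfl }
  ; enough = ≤-reflexive (sym (+-identityʳ n)) }
components {suc N} {n} end x _~_ rfl sy tr edge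
  with components (end ∘ suc) (x ∘ suc) _~_ rfl sy tr (edge ∘ suc) | x zero in x₀
... | record { r = r ; ℓ = ℓ ; rep = rep ; ℓ∘rep = ℓ∘rep ; respect = respect ; linked = linked ; enough = enough } | false = record
  { r = r ; ℓ = ℓ ; rep = rep ; ℓ∘rep = ℓ∘rep
  ; respect = λ { zero h → true≢false h x₀ ; (suc e) h → respect e h }
  ; linked = linked
  ; enough = subst (λ b → n ≤ r + (bit b + cnt (x ∘ suc))) (sym x₀) enough }
... | record { r = r ; ℓ = ℓ ; rep = rep ; ℓ∘rep = ℓ∘rep ; respect = respect ; linked = linked ; enough = enough } | true
  with ℓ (proj₁ (end zero)) ≟ ℓ (proj₂ (end zero))
... | yes eq = record
  { r = r ; ℓ = ℓ ; rep = rep ; ℓ∘rep = ℓ∘rep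
  ; respect = λ { zero h → eq ; (suc e) h → respect e h }
  ; linked = linked
  ; enough = subst (λ b → n ≤ r + (bit b + cnt (x ∘ suc))) (sym x₀)
      (≤-trans enough (+-monoʳ-≤ r (n≤1+n _))) }
components {suc N} {n} end x _~_ rfl sy tr edge
  | record { r = zero ; ℓ = ℓ } | true | no ne with ℓ (proj₁ (end zero))
... | ()
components {suc N} {n} end x _~_ rfl sy tr edge
  | record { r = suc r ; ℓ = ℓ ; rep = rep ; ℓ∘rep = ℓ∘rep ; respect = respect ; linked = linked ; enough = enough } | true | no ne = record
  { r = r ; ℓ = π ∘ ℓ ; rep = rep ∘ section
  ; ℓ∘rep = λ z → trans (cong π (ℓ∘rep (section z))) (π∘section z)
  ; respect = λ { zero h → glues ; (suc e) h → cong π (respect e h) }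
  ; linked = λ h → link (only h)
  ; enough = subst (λ b → n ≤ r + (bit b + cnt (x ∘ suc))) (sym x₀)
      (≤-trans enough (≤-reflexive (sym (+-suc r _)))) }
  where
  open Collapse (collapse ne)
  e₀ = edge zero x₀
  link : ∀ {i j} → ℓ i ≡ ℓ j ⊎ ((ℓ i ≡ _ × ℓ j ≡ _) ⊎ (ℓ i ≡ _ × ℓ j ≡ _)) → i ~ j
  link (inj₁ h)               = linked h
  link (inj₂ (inj₁ (hi , hj))) = tr (linked hi) (tr e₀ (linked (sym hj)))
  link (inj₂ (inj₂ (hi , hj))) = tr (linked hi) (tr (sy e₀) (linked (sym hj)))

module _ {n : ℕ} {x : Graph n} where

  reach-trans : ∀ {i j k} → Reach n x i j → Reach n x j k → Reach n x i k
  reach-trans p here       = p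
  reach-trans p (step q a) = step (reach-trans p q) a

  adj-sym : ∀ {i j} → Adj n x i j → Adj n x j i
  adj-sym (e , j , h) = e , swap j , h

  reach-adj : ∀ {i j} → Adj n x i j → Reach n x i j
  reach-adj a = step here a

  reach-sym : ∀ {i j} → Reach n x i j → Reach n x j i
  reach-sym here       = here
  reach-sym (step p a) = reach-trans (reach-adj (adj-sym a)) (reach-sym p)

  reach-respects : {A : Set} (ℓ : Fin n → A) →
                   (∀ {i j} → Adj n x i j → ℓ i ≡ ℓ j) → ∀ {i j} → Reach n x i j → ℓ i ≡ ℓ j
  reach-respects ℓ h here       = refl
  reach-respects ℓ h (step p a) = trans (reach-respects ℓ h p) (h a)

  adj-respects : {A : Set} (ℓ : Fin n → A) →
                 (∀ e → x e ≡ true → ℓ (proj₁ (ends n e)) ≡ ℓ (proj₂ (ends n e))) →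
                 ∀ {i j} → Adj n x i j → ℓ i ≡ ℓ j
  adj-respects ℓ h (e , inj₁ p , t) = let a , b = ,-injective p in trans (cong ℓ (sym a)) (trans (h e t) (cong ℓ b))
  adj-respects ℓ h (e , inj₂ p , t) = let a , b = ,-injective p in trans (cong ℓ (sym b)) (trans (sym (h e t)) (cong ℓ a))

adj? : ∀ n (x : Graph n) i j → Dec (Adj n x i j)
adj? n x i j = any? λ e → joins? e i j ×-dec (x e Bool.≟ true)

adj-ext : ∀ {n} {x y : Graph n} → (∀ e → x e ≡ y e) → ∀ {i j} → Adj n x i j → Adj n y i j
adj-ext h (e , j , t) = e , j , trans (sym (h e)) t

graphComponents : ∀ n (x : Graph n) → Components (ends n) x (Reach n x)
graphComponents n x = components (ends n) x (Reach n x) here reach-sym reach-trans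
  (λ e h → reach-adj (e , joins-ends e , h))

conn-ext : ∀ n → Extensional (CONN n)
conn-ext n {x} {y} h c i j = go (c i j)
  where
  go : ∀ {j} → Reach n x i j → Reach n y i j
  go here       = here
  go (step p a) = step (go p) (adj-ext h a)

-- Component labels turn reachability into a decidable equality.
conn? : ∀ n x → Dec (CONN n x)
conn? n x = map′ (λ h i j → linked (h i j)) (λ c i j → reach-respects ℓ (adj-respects ℓ respect) (c i j))
                 (all? λ i → all? λ j → ℓ i ≟ ℓ j)
  where open Components (graphComponents n x)

-- Connectedness leaves at most one label, and `enough` becomes the bound.
conn⇒edges : ∀ n x → CONN n x → n ≤ suc (cnt x)
conn⇒edges n x c with graphComponents n x
... | record { r = zero ; enough = enough } = m≤n⇒m≤1+n enough
... | record { r = suc zero ; enough = enough } = enough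
... | record { r = suc (suc r) ; ℓ = ℓ ; rep = rep ; ℓ∘rep = ℓ∘rep ; respect = respect }
  with trans (sym (ℓ∘rep zero)) (trans (reach-respects ℓ (adj-respects ℓ respect) (c (rep zero) (rep (suc zero)))) (ℓ∘rep (suc zero)))
... | ()

-- For u ≠ v, the edge uv and the paths u–w–v for the other w are n-1
-- edge-disjoint connections, and deleting fewer than n-1 edges spares one.
cut-large : ∀ n (S x : Graph (suc n)) → (∀ e → S e ≡ false → x e ≡ true) →
            cnt S < n → CONN (suc n) x
cut-large n S x spare small u v with u ≟ v
... | yes refl = here
-- The choice `w = v` stands for the edge `uv` itself: the second half of the path is then empty.
... | no u≢v with any? (λ w → ¬? (w ≟ u) ×-dec (¬? (adj? (suc n) S u w) ×-dec ¬? (adj? (suc n) S w v)))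
... | yes (w , w≢u , uw , wv) = reach-trans (direct uw) (direct wv)
  where
  direct : ∀ {a b} → ¬ Adj (suc n) S a b → Reach (suc n) x a b
  direct {a} {b} free with a ≟ b
  ... | yes refl = here
  ... | no a≢b with edge-between a≢b
  ...   | e , j with S e in eq
  ...     | true  = ⊥-elim (free (e , j , eq))
  ...     | false = reach-adj (e , j , spare e eq)
... | no none = ⊥-elim (<⇒≱ small (cnt-injection blocker injective (λ i → proj₁ (proj₂ (block i)))))
  where
  -- Every connection via a vertex other than `u` loses an edge to `S`. The other end `z` is
  -- remembered to show that the edges differ; the clause `punchIn u i ≢ v` keeps `uv` from being
  -- counted from its end `u` as well.
  block : ∀ (i : Fin n) → ∃[ e ] (S e ≡ true × ∃[ z ] (Joins {suc n} e z (punchIn u i) × (z ≡ u ⊎ (z ≡ v × punchIn u i ≢ v))))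
  block i with adj? (suc n) S u (punchIn u i) | adj? (suc n) S (punchIn u i) v
  ... | yes (e , j , s) | _ = e , s , u , j , inj₁ refl
  ... | no _ | yes (e , j , s) = e , s , v , joins-sym j , inj₂ (refl , joins-irrefl j)
  ... | no a | no b = ⊥-elim (none (punchIn u i , punchInᵢ≢i u i , a , b))
  blocker : Fin n → Fin (E (suc n))
  blocker i = proj₁ (block i)
  injective : ∀ {i j} → blocker i ≡ blocker j → i ≡ j
  injective {i} {j} eq with block i | block j
  ... | e , _ , z , jz , cz | e′ , _ , z′ , jz′ , cz′ with eq
  ... | refl with joins-same jz jz′
  ... | inj₁ (_ , q) = punchIn-injective u i j q
  ... | inj₂ (p , q) = ⊥-elim (cross cz cz′)
    where
    cross : z ≡ u ⊎ (z ≡ v × punchIn u i ≢ v) → z′ ≡ u ⊎ (z′ ≡ v × punchIn u j ≢ v) → ⊥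
    cross (inj₁ zu) _ = punchInᵢ≢i u j (trans (sym p) zu)
    cross _ (inj₁ zu) = punchInᵢ≢i u i (trans q zu)
    cross (inj₂ (zv , _)) (inj₂ (_ , ne)) = ne (trans (sym p) zv)

-- Outside `S` the input is replaced by the value that works against it: by 0 if it is connected, so
-- the 1-edges in `S` alone connect all vertices; by 1 if it is not, so `S` must be large by
-- `cut-large`.
conn-cert-≥ : ∀ n x (S : Subset (E (suc n))) → IsCert (CONN (suc n)) x S → n ≤ ∣ S ∣
conn-cert-≥ n x S cert with conn? (suc n) x
... | yes c = ≤-trans (s≤s⁻¹ (conn⇒edges (suc n) _ (Equivalence.from (cert y agree) c)))
                (≤-trans (cnt-mono λ e → Bool.∧-conicalˡ (lookup S e) (x e)) (≤-reflexive (sym (∣∣≡cnt S))))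
  where
  y : Graph (suc n)
  y e = lookup S e ∧ x e
  agree : ∀ e → e ∈ₛ S → y e ≡ x e
  agree e m rewrite ∈⇒ m = refl
... | no ¬c = ≮⇒≥ λ small → ¬c (Equivalence.to (cert y agree)
                (cut-large n (lookup S) y spare (subst (_< n) (∣∣≡cnt S) small)))
  where
  y : Graph (suc n)
  y e = if lookup S e then x e else true
  agree : ∀ e → e ∈ₛ S → y e ≡ x e
  agree e m rewrite ∈⇒ m = refl
  spare : ∀ e → lookup S e ≡ false → y e ≡ true
  spare e m rewrite m = refl

-- The adversary for connectivity

fill-yes : ∀ {N} (ρ : Partial N) {e} → fill ρ e ≡ true → ρ e ≡ just true
fill-yes ρ {e} h with ρ e
fill-yes ρ refl | just true = refl
fill-yes ρ ()   | nothing

fill-update : ∀ {N} (ρ : Partial N) {e b j} → j ≢ e → fill (ρ [ e ↦ b ]) j ≡ fill ρ j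
fill-update ρ {e} {b} {j} ne rewrite update-other ρ {e} {b} ne = refl

fill-at : ∀ {N} (ρ : Partial N) {e b} → ρ e ≡ just b → fill ρ e ≡ b
fill-at ρ h rewrite h = refl

fill-unqueried : ∀ {N} (ρ : Partial N) {e} → ρ e ≡ nothing → fill ρ e ≡ false
fill-unqueried ρ h rewrite h = refl

cnt-fill-true : ∀ {N} (ρ : Partial N) {e} → ρ e ≡ nothing →
                cnt (fill (ρ [ e ↦ true ])) ≡ suc (cnt (fill ρ))
cnt-fill-true ρ {e} un = cnt-flip e (fill-at (ρ [ e ↦ true ]) (update-same ρ e true)) (fill-unqueried ρ un)
  λ j ne → fill-update ρ ne

cnt-fill-false : ∀ {N} (ρ : Partial N) {e} → ρ e ≡ nothing →
                 cnt (fill (ρ [ e ↦ false ])) ≡ cnt (fill ρ)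
cnt-fill-false ρ {e} un = cnt-cong same
  where
  same : ∀ j → fill (ρ [ e ↦ false ]) j ≡ fill ρ j
  same j with j ≟ e
  ... | yes refl = trans (fill-at (ρ [ e ↦ false ]) (update-same ρ e false)) (sym (fill-unqueried ρ un))
  ... | no ne    = fill-update ρ ne

module ConnGame (n : ℕ) where

  src tgt : Fin (E n) → Fin n
  src e = proj₁ (ends n e)
  tgt e = proj₂ (ends n e)

  Between : ∀ {r} → (Fin n → Fin r) → Fin (E n) → Fin r → Fin r → Set
  Between ℓ e a b = (ℓ (src e) ≡ a × ℓ (tgt e) ≡ b) ⊎ (ℓ (src e) ≡ b × ℓ (tgt e) ≡ a)

  -- The classes of ℓ are the components of the graph of 1-answers. An edge
  -- between two classes is answered 1 only if it is the last one between them,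
  -- so all edges inside a class have been queried, and none of them is wasted.
  record Position (ρ : Partial (E n)) : Set where
    field
      r       : ℕ
      -- There are always at least two classes, so connectedness is still undecided.
      ℓ       : Fin n → Fin (2 + r)
      rep     : Fin (2 + r) → Fin n
      ℓ∘rep   : ∀ z → ℓ (rep z) ≡ z
      across  : ∀ {e} → ρ e ≡ nothing → ℓ (src e) ≢ ℓ (tgt e)
      open-between : ∀ {a b} → a ≢ b → ∃[ e ] (ρ e ≡ nothing × Between ℓ e a b)
      within  : ∀ {e} → ρ e ≡ just true → ℓ (src e) ≡ ℓ (tgt e)
      forest  : 2 + r + cnt (fill ρ) ≡ n
      linked  : ∀ {x} → ρ ⊑ x → ∀ {i j} → ℓ i ≡ ℓ j → Reach n x i j

  -- A connected graph on all vertices with `n - 1` edges is a tree; its edges will be the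
  -- certificate.
  HasSpanningTree : Graph n → Set
  HasSpanningTree x = ∃[ y ] (CONN n y × (∀ e → y e ≡ true → x e ≡ true) × suc (cnt y) ≡ n)

  twoClasses : ∀ {a b c d : Fin 2} → a ≢ b → c ≢ d → (c ≡ a × d ≡ b) ⊎ (c ≡ b × d ≡ a)
  twoClasses {zero}     {zero}     p q = ⊥-elim (p refl)
  twoClasses {suc zero} {suc zero} p q = ⊥-elim (p refl)
  twoClasses {_} {_} {zero}     {zero}     p q = ⊥-elim (q refl)
  twoClasses {_} {_} {suc zero} {suc zero} p q = ⊥-elim (q refl)
  twoClasses {zero}     {suc zero} {zero}     {suc zero} p q = inj₁ (refl , refl)
  twoClasses {zero}     {suc zero} {suc zero} {zero}     p q = inj₂ (refl , refl)
  twoClasses {suc zero} {zero}     {zero}     {suc zero} p q = inj₂ (refl , refl)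
  twoClasses {suc zero} {zero}     {suc zero} {zero}     p q = inj₁ (refl , refl)

  merged : ∀ {r} {ℓ : Fin n → Fin r} {e x} → (∀ {i j} → ℓ i ≡ ℓ j → Reach n x i j) → x e ≡ true →
           ∀ {i j} → ℓ i ≡ ℓ j ⊎ ((ℓ i ≡ ℓ (src e) × ℓ j ≡ ℓ (tgt e)) ⊎ (ℓ i ≡ ℓ (tgt e) × ℓ j ≡ ℓ (src e))) →
           Reach n x i j
  merged linked t (inj₁ h) = linked h
  merged {e = e} linked t (inj₂ (inj₁ (hi , hj))) =
    reach-trans (linked hi) (reach-trans (reach-adj (e , joins-ends e , t)) (linked (sym hj)))
  merged {e = e} linked t (inj₂ (inj₂ (hi , hj))) =
    reach-trans (linked hi) (reach-trans (reach-adj (e , joins-sym (joins-ends e) , t)) (linked (sym hj)))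

  module _ {ρ : Partial (E n)} (pos : Position ρ) {e : Fin (E n)} (un : ρ e ≡ nothing) where
    open Position pos

    other? : Dec (∃[ e′ ] (e′ ≢ e × ρ e′ ≡ nothing × Between ℓ e′ (ℓ (src e)) (ℓ (tgt e))))
    other? = any? λ e′ → ¬? (e′ ≟ e) ×-dec (isNothing? (ρ e′) ×-dec
      ((ℓ (src e′) ≟ _ ×-dec ℓ (tgt e′) ≟ _) ⊎-dec (ℓ (src e′) ≟ _ ×-dec ℓ (tgt e′) ≟ _)))

    keep : (∃[ e′ ] (e′ ≢ e × ρ e′ ≡ nothing × Between ℓ e′ (ℓ (src e)) (ℓ (tgt e)))) →
           Position (ρ [ e ↦ false ])
    keep (e′ , ne , un′ , betw′) = record
      { r = r ; ℓ = ℓ ; rep = rep ; ℓ∘rep = ℓ∘rep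
      ; across = λ h → across (proj₂ (update-nothing ρ h))
      ; open-between = still
      ; within = λ h → within (yes⁻ h)
      ; forest = trans (cong (2 + r +_) (cnt-fill-false ρ un)) forest
      ; linked = λ s → linked (⊑-update⁻ ρ un s) }
      where
      yes⁻ : ∀ {j} → (ρ [ e ↦ false ]) j ≡ just true → ρ j ≡ just true
      yes⁻ h with update-just ρ h
      ... | inj₂ (_ , h′) = h′
      transfer : ∀ {a b} → Between ℓ e a b → Between ℓ e′ a b
      transfer (inj₁ (refl , refl)) = betw′
      transfer (inj₂ (refl , refl)) = swap betw′
      still : ∀ {a b} → a ≢ b → ∃[ j ] ((ρ [ e ↦ false ]) j ≡ nothing × Between ℓ j a b)
      still a≢b with open-between a≢b
      ... | j , unj , betw with j ≟ e
      -- If `e` was the promised open edge between its two classes, `e′` takes its place.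
      ...   | yes refl = e′ , trans (update-other ρ ne) un′ , transfer betw
      ...   | no j≢e   = j , trans (update-other ρ j≢e) unj , betw

  -- With more than two classes, a 1 on the last edge between two of them merges them. With exactly
  -- two, every open edge runs between them, so the last one is the last open edge of all and
  -- decides.
  answerConn : ∀ {ρ e} → Position ρ → ρ e ≡ nothing →
               (∃[ b ] Position (ρ [ e ↦ b ])) ⊎
               ((∀ {j} → j ≢ e → ρ j ≢ nothing)
                 × (∀ {x} → ρ [ e ↦ true ] ⊑ x → HasSpanningTree x)
                 × (∀ {x} → ρ [ e ↦ false ] ⊑ x → ¬ CONN n x))
  answerConn {ρ} {e} pos un with other? pos un
  ... | yes o = inj₁ (false , keep pos un o)
  answerConn {ρ} {e} pos@(record { r = zero ; ℓ = ℓ ; across = across ; within = within ; forest = forest ; linked = linked }) un | no last =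
    inj₂ (queried , tree , disconnected)
    where
    queried : ∀ {j} → j ≢ e → ρ j ≢ nothing
    queried j≢e unj = last (_ , j≢e , unj , twoClasses (across un) (across unj))
    spanning : ∀ {x} → ρ [ e ↦ true ] ⊑ x → CONN n x
    spanning s i j = merged (λ {i} {j} → linked (⊑-update⁻ ρ un s) {i} {j}) (⊑-at ρ s) (split i j)
      where
      split : ∀ i j → ℓ i ≡ ℓ j ⊎ ((ℓ i ≡ ℓ (src e) × ℓ j ≡ ℓ (tgt e)) ⊎ (ℓ i ≡ ℓ (tgt e) × ℓ j ≡ ℓ (src e)))
      split i j with ℓ i ≟ ℓ j
      ... | yes eq = inj₁ eq
      ... | no ne  = inj₂ (twoClasses (across un) ne)
    tree : ∀ {x} → ρ [ e ↦ true ] ⊑ x → HasSpanningTree x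
    tree s = fill (ρ [ e ↦ true ]) , spanning (⊑-fill (ρ [ e ↦ true ])) ,
      (λ j h → s j (fill-yes (ρ [ e ↦ true ]) h)) ,
      trans (cong suc (cnt-fill-true ρ un)) forest
    disconnected : ∀ {x} → ρ [ e ↦ false ] ⊑ x → ¬ CONN n x
    -- The labelling itself is the cut: it is constant along all 1-edges of `x` but separates the
    -- ends of `e`.
    disconnected {x} s c = across un (reach-respects ℓ (adj-respects ℓ respect) (c (src e) (tgt e)))
      where
      respect : ∀ j → x j ≡ true → ℓ (src j) ≡ ℓ (tgt j)
      respect j t with j ≟ e | ρ j in eq
      ... | yes refl | _          = true≢false t (⊑-at ρ s)
      ... | no ne    | nothing    = ⊥-elim (queried ne eq)
      ... | no ne    | just true  = within eq
      ... | no ne    | just false = true≢false t (⊑-update⁻ ρ un s j eq)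
  answerConn {ρ} {e} pos@(record { r = suc r ; ℓ = ℓ ; rep = rep ; ℓ∘rep = ℓ∘rep ; across = across ; open-between = open-between ; within = within ; forest = forest ; linked = linked }) un | no last =
    inj₁ (true , record
      { r = r ; ℓ = π ∘ ℓ ; rep = rep ∘ section
      ; ℓ∘rep = λ z → trans (cong π (ℓ∘rep (section z))) (π∘section z)
      ; across = across′
      ; open-between = open-between′
      ; within = within′
      ; forest = trans (cong (2 + r +_) (cnt-fill-true ρ un)) (trans (+-suc (2 + r) _) forest)
      ; linked = λ s h → merged (λ {i} {j} → linked (⊑-update⁻ ρ un s) {i} {j}) (⊑-at ρ s) (only h) })
    where
    open Collapse (collapse (across un))
    -- An open edge inside the merged class would be a second open edge between the two old ones.
    across′ : ∀ {j} → (ρ [ e ↦ true ]) j ≡ nothing → π (ℓ (src j)) ≢ π (ℓ (tgt j))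
    across′ h eq with update-nothing ρ h | only eq
    ... | ne , unj | inj₁ same = across unj same
    ... | ne , unj | inj₂ betw = last (_ , ne , unj , betw)
    project : ∀ {j a b} → Between ℓ j (section a) (section b) → Between (π ∘ ℓ) j a b
    project (inj₁ (p , q)) = inj₁ (trans (cong π p) (π∘section _) , trans (cong π q) (π∘section _))
    project (inj₂ (p , q)) = inj₂ (trans (cong π p) (π∘section _) , trans (cong π q) (π∘section _))
    open-between′ : ∀ {a b} → a ≢ b → ∃[ j ] ((ρ [ e ↦ true ]) j ≡ nothing × Between (π ∘ ℓ) j a b)
    open-between′ {a} {b} a≢b
      with open-between {section a} {section b} (λ eq → a≢b (trans (sym (π∘section a)) (trans (cong π eq) (π∘section b))))
    ... | j , unj , betw = j , trans (update-other ρ (j≢e (project betw))) unj , project betw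
      where
      j≢e : Between (π ∘ ℓ) j a b → j ≢ e
      j≢e (inj₁ (p , q)) refl = a≢b (trans (sym p) (trans glues q))
      j≢e (inj₂ (p , q)) refl = a≢b (trans (sym q) (trans (sym glues) p))
    within′ : ∀ {j} → (ρ [ e ↦ true ]) j ≡ just true → π (ℓ (src j)) ≡ π (ℓ (tgt j))
    within′ h with update-just ρ h
    ... | inj₁ (refl , _) = glues
    ... | inj₂ (_ , h′)   = cong π (within h′)

  connAdversary : Adversary (CONN n) HasSpanningTree Position
  connAdversary = record
    { live = λ pos → let e , un , _ = Position.open-between pos {zero} {suc zero} (λ ()) in e , un
    ; answer = answerConn }

connStart : ∀ n → ConnGame.Position (2 + n) (λ _ → nothing)
connStart n = record
  { r = n ; ℓ = λ i → i ; rep = λ i → i ; ℓ∘rep = λ _ → refl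
  ; across = λ {e} _ → joins-irrefl {2 + n} {e} (joins-ends e)
  ; open-between = λ a≢b → let e , j = edge-between a≢b in e , refl , [ (λ p → inj₁ (,-injective p)) , (λ p → inj₂ (,-injective p)) ]′ j
  ; within = λ ()
  ; forest = trans (cong (2 + n +_) (cnt-none {E (2 + n)} λ _ → refl)) (+-identityʳ _)
  ; linked = λ { _ refl → here } }

conn-hard : ∀ n T → Computes (CONN (2 + n)) T →
            ∃[ x ] (E (2 + n) ≤ cost T x × ∃[ S ] (IsCert (CONN (2 + n)) x S × ∣ S ∣ ≤ suc n))
conn-hard n T c =
  let x , (y , cy , sub , size) , le = adversary-hard (λ (y , cy , sub , _) → upward sub cy) connAdversary (connStart n) T c
  in x , le , tabulate y ,
     (λ z agree → mk⇔ (λ _ → upward sub cy)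
                      (λ _ → upward (λ e h → trans (agree e (⇒∈tab y h)) (sub e h)) cy)) ,
     ≤-reflexive (trans (∣tabulate∣ y) (+-cancelˡ-≡ 1 _ _ size))
  where
  open ConnGame (2 + n)
  upward : ∀ {x y : Graph (2 + n)} → (∀ e → y e ≡ true → x e ≡ true) → CONN (2 + n) y → CONN (2 + n) x
  upward {x} {y} sub c i j = go (c i j)
    where
    go : ∀ {j} → Reach (2 + n) y i j → Reach (2 + n) x i j
    go here                   = here
    go (step p (e , jn , t)) = step (go p) (e , jn , sub e t)

E≡C2 : ∀ n → E n ≡ n C 2
E≡C2 zero    = refl
E≡C2 (suc n) = trans (cong₂ _+_ (sym (nC1≡n n)) (E≡C2 n)) (nCk+nC[k+1]≡[n+1]C[k+1] n 1)

conn-theorem : ∀ n → 2 ≤ n →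
  ∃[ d ] ∃[ m ] (IsDT (CONN n) d × IsCmin (CONN n) m × 1 ≤ m × IsInstC (CONN n) d m × d * (n ∸ 1) ≡ (n C 2) * m)
conn-theorem (suc (suc n)) (s≤s (s≤s z≤n)) = E (2 + n) , suc n ,
  evasive⇒IsDT ext dec cert hard , evasive⇒IsCmin ext dec cert hard , s≤s z≤n ,
  evasive⇒IsInstC ext dec cert hard , cong (_* suc n) (E≡C2 (2 + n))
  where
  ext = λ {x} {y} → conn-ext (2 + n) {x} {y}
  dec = conn? (2 + n)
  cert = conn-cert-≥ (suc n)
  hard = conn-hard n

-- Cliques

adj⇒edge : ∀ {n} {x : Graph n} {e} {u v : Fin n} → Adj n x u v → Joins e u v → x e ≡ true
adj⇒edge {x = x} (e′ , j′ , t) j = trans (cong x (joins-unique j j′)) t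

clique-ext : ∀ n k → Extensional (CL n k)
clique-ext n k h (S , size , c) = S , size , λ i j p q ne → adj-ext h (c i j p q ne)

clique? : ∀ n k x → Dec (CL n k x)
clique? n k x = anySubset? λ S → (∣ S ∣ ℕ.≟ k) ×-dec
  (all? λ i → all? λ j → (i ∈? S) →-dec ((j ∈? S) →-dec (¬? (i ≟ j) →-dec adj? n x i j)))

clique-from : ∀ {n k} {x : Graph n} (K : Fin n → Bool) → cnt K ≡ k →
              (∀ e → inside K e ≡ true → x e ≡ true) → CL n k x
clique-from {n} {x = x} K size all = tabulate K , trans (∣tabulate∣ K) size , λ i j p q ne →
  let e , jn = edge-between ne in e , jn , all e (⇒inside jn (∈tab⇒ K p) (∈tab⇒ K q))

clique-edges : ∀ {n k} {x : Graph n} → CL n k x →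
               Σ (Fin n → Bool) λ K → cnt K ≡ k × (∀ {e} {u v : Fin n} → Joins e u v → K u ≡ true → K v ≡ true → x e ≡ true)
clique-edges (S , size , c) = lookup S , trans (sym (∣∣≡cnt S)) size ,
  λ {e} {u} {v} j p q → adj⇒edge (c u v (⇒∈ p) (⇒∈ q) (joins-irrefl {e = e} j)) j

clique⇒cert : ∀ {n k} {x : Graph n} → CL n k x → ∃[ S ] (IsCert (CL n k) x S × ∣ S ∣ ≤ E k)
clique⇒cert {n} {k} {x} cl with clique-edges cl
... | K , size , all = tabulate (inside K) ,
  (λ y agree → mk⇔ (λ _ → cl) (λ _ → clique-from K size λ e h →
     trans (agree e (⇒∈tab (inside K) h)) (all-inside e h))) ,
  ≤-reflexive (trans (∣tabulate∣ (inside K)) (trans (cnt-inside K) (cong E size)))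
  where
  all-inside : ∀ e → inside K e ≡ true → x e ≡ true
  all-inside e h = let a , b = inside⇒ {n} {K} {e} (joins-ends e) h in all {e} (joins-ends e) a b

-- As for connectivity, the input is filled outside `S` with 0 in the first case and with 1 in the
-- second, where `turán` would find a clique avoiding a small `S`.
clique-cert-≥ : ∀ n k .{{_ : ℕ.NonZero k}} .{{_ : ℕ.NonZero (2 * k)}} → k ^ 3 * 2 ^ 3 ≤ n ^ 2 →
                ∀ x (S : Subset (E n)) → IsCert (CL n k) x S → E k ≤ ∣ S ∣
clique-cert-≥ n k big x S cert with clique? n k x
... | yes c =
  let K , size , all = clique-edges (Equivalence.from (cert y agree) c)
  in begin
    E k              ≡⟨ cong E size ⟨
    E (cnt K)        ≡⟨ cnt-inside K ⟨
    cnt (inside K)   ≤⟨ cnt-mono (λ e h → let a , b = inside⇒ {n} {K} {e} (joins-ends e) h in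
                          Bool.∧-conicalˡ (lookup S e) (x e) (all {e} (joins-ends e) a b)) ⟩
    cnt (lookup S)   ≡⟨ ∣∣≡cnt S ⟨
    ∣ S ∣            ∎
  where
  open ≤-Reasoning
  y : Graph n
  y e = lookup S e ∧ x e
  agree : ∀ e → e ∈ₛ S → y e ≡ x e
  agree e m rewrite ∈⇒ m = refl
... | no ¬c = ≮⇒≥ λ small →
  let K , size , free = turán n k (lookup S) big
        (<-≤-trans (subst (_< E k) (∣∣≡cnt S) small) (E≤square k))
  in ¬c (Equivalence.to (cert y agree) (clique-from K size λ e h → spare e (free e) h))
  where
  y : Graph n
  y e = if lookup S e then x e else true
  agree : ∀ e → e ∈ₛ S → y e ≡ x e
  agree e m rewrite ∈⇒ m = refl
  spare : ∀ e {A : Set} → (lookup S e ≡ true → A → ⊥) → A → y e ≡ true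
  spare e f a with lookup S e
  ... | true  = ⊥-elim (f refl a)
  ... | false = refl

-- A leaf hangs from its parent by the 1-edge received when its last rim edge
-- was queried; it is dead once one of its spokes has been answered 0.
data Status (n : ℕ) : Set where
  root      : Status n
  leaf dead : Fin n → Status n

parent : ∀ {n} → Status n → Maybe (Fin n)
parent root     = nothing
parent (leaf c) = just c
parent (dead c) = just c

isLeaf? : ∀ {n} (t : Status n) c → Dec (t ≡ leaf c)
isLeaf? root     c = no λ ()
isLeaf? (dead _) c = no λ ()
isLeaf? (leaf d) c = map′ (cong leaf) (λ { refl → refl }) (d ≟ c)

-- Cliques relative to a set of hubs

module CliqueGame {n : ℕ} (hub : Fin n → Bool) where

  -- An edge with exactly one end among the hubs is a spoke, an edge avoiding
  -- the hubs is a rim edge, and the edges between hubs form the core.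
  Edge : Set
  Edge = Fin (E n)

  Spoke : Edge → Fin n → Set
  Spoke e w = ∃[ h ] (Joins e h w × hub h ≡ true × hub w ≡ false)

  Rim : Edge → Fin n → Fin n → Set
  Rim e u v = Joins e u v × hub u ≡ false × hub v ≡ false

  data Kind (e : Edge) : Set where
    core  : inside hub e ≡ true → Kind e
    spoke : ∀ {w} → Spoke e w → Kind e
    rim   : ∀ {u v} → Rim e u v → Kind e

  kind : ∀ e → Kind e
  kind e with hub (proj₁ (ends n e)) in p | hub (proj₂ (ends n e)) in q
  ... | true  | true  = core (⇒inside {n} {hub} {e} (joins-ends e) p q)
  ... | true  | false = spoke (_ , joins-ends e , p , q)
  ... | false | true  = spoke (_ , joins-sym (joins-ends e) , q , p)
  ... | false | false = rim (joins-ends e , p , q)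

  spoke? : ∀ e w → Dec (Spoke e w)
  spoke? e w = any? λ h → joins? e h w ×-dec (hub h Bool.≟ true) ×-dec (hub w Bool.≟ false)

  rim? : ∀ e u v → Dec (Rim e u v)
  rim? e u v = joins? e u v ×-dec (hub u Bool.≟ false) ×-dec (hub v Bool.≟ false)

  rim-sym : ∀ {e u v} → Rim e u v → Rim e v u
  rim-sym (j , p , q) = joins-sym j , q , p

  rim-≢ : ∀ {e u v} → Rim e u v → u ≢ v
  rim-≢ {e} (j , _) = joins-irrefl {e = e} j

  rim-same : ∀ {e u v u′ v′} → Rim e u v → Rim e u′ v′ → (u ≡ u′ × v ≡ v′) ⊎ (u ≡ v′ × v ≡ u′)
  rim-same (j , _) (j′ , _) = joins-same j j′

  spoke-same : ∀ {e w w′} → Spoke e w → Spoke e w′ → w ≡ w′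
  spoke-same (_ , j , h , _) (_ , j′ , _ , r) with joins-same j j′
  ... | inj₁ (_ , eq)   = eq
  ... | inj₂ (refl , _) = true≢false h r

  spoke-not-rim : ∀ {e w u v} → Spoke e w → ¬ Rim e u v
  spoke-not-rim (_ , j , h , _) (j′ , r , r′) with joins-same j j′
  ... | inj₁ (refl , _) = true≢false h r
  ... | inj₂ (refl , _) = true≢false h r′

  core-not-spoke : ∀ {e w} → inside hub e ≡ true → ¬ Spoke e w
  core-not-spoke c (_ , j , _ , r) = true≢false (proj₂ (inside⇒ {p = hub} j c)) r

  core-not-rim : ∀ {e u v} → inside hub e ≡ true → ¬ Rim e u v
  core-not-rim c (j , r , _) = true≢false (proj₁ (inside⇒ {p = hub} j c)) r

  not-core : ∀ {e} → (inside hub e ≡ true → ⊥) → inside hub e ≡ false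
  not-core {e} f with inside hub e
  ... | true  = ⊥-elim (f refl)
  ... | false = refl

  spoke-outer : ∀ {e w} → Spoke e w → inside hub e ≡ false
  spoke-outer s = not-core λ c → core-not-spoke c s

  rim-outer : ∀ {e u v} → Rim e u v → inside hub e ≡ false
  rim-outer r = not-core λ c → core-not-rim c r

  -- The edge set `Y` is a parameter because the notions built on it serve both for the 1-answers of
  -- a position and for the 1-edges of an input.
  Linked : (Edge → Set) → Fin n → Fin n → Set
  Linked Y u v = ∃[ e ] (Rim e u v × Y e)

  TriangleFree : (Edge → Set) → Set
  TriangleFree Y = ∀ {u v w} → Linked Y u v → Linked Y v w → ¬ Linked Y u w

  GoodPair : (Edge → Set) → Set
  GoodPair Y = ∃[ u ] ∃[ v ] (Linked Y u v × (∀ {e} → Spoke e u → Y e) × (∀ {e} → Spoke e v → Y e))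

  linked-sym : ∀ {Y u v} → Linked Y u v → Linked Y v u
  linked-sym (e , r , y) = e , rim-sym r , y

  On : Graph n → Edge → Set
  On x e = x e ≡ true

  clique-intro : ∀ {x} → (∀ e → inside hub e ≡ true → On x e) → GoodPair (On x) → CL n (2 + cnt hub) x
  clique-intro {x} cores (u , v , (e₀ , r₀@(j₀ , ¬hu , ¬hv) , y₀) , spokesᵤ , spokesᵥ) =
    clique-from K (trans (cnt-flip v K-v K′-v λ j ne → set-other K′ ne)
                         (cong suc (cnt-flip u (set-same hub u true) ¬hu λ j ne → set-other hub ne)))
      λ e h → let a , b = inside⇒ {n} {K} {e} (joins-ends e) h in present (joins-ends e) (member a) (member b)
    where
    K′ K : Fin n → Bool
    K′ = set hub u true
    K  = set K′ v true
    K-v : K v ≡ true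
    K-v = set-same K′ v true
    K′-v : K′ v ≡ false
    K′-v = trans (set-other hub (≢-sym (rim-≢ r₀))) ¬hv
    member : ∀ {i} → K i ≡ true → i ≡ v ⊎ (i ≡ u ⊎ hub i ≡ true)
    member h with set-cases K′ h
    ... | inj₁ (eq , _) = inj₁ eq
    ... | inj₂ (_ , h′) with set-cases hub h′
    ...   | inj₁ (eq , _) = inj₂ (inj₁ eq)
    ...   | inj₂ (_ , h″) = inj₂ (inj₂ h″)
    present : ∀ {e i j} → Joins e i j → i ≡ v ⊎ (i ≡ u ⊎ hub i ≡ true) → j ≡ v ⊎ (j ≡ u ⊎ hub j ≡ true) → On x e
    present {e} jn (inj₁ refl) (inj₁ refl)               = ⊥-elim (joins-irrefl {e = e} jn refl)
    present {e} jn (inj₂ (inj₁ refl)) (inj₂ (inj₁ refl)) = ⊥-elim (joins-irrefl {e = e} jn refl)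
    present jn (inj₁ refl) (inj₂ (inj₁ refl))        = trans (cong x (joins-unique (joins-sym jn) j₀)) y₀
    present jn (inj₂ (inj₁ refl)) (inj₁ refl)        = trans (cong x (joins-unique jn j₀)) y₀
    present jn (inj₁ refl) (inj₂ (inj₂ h))           = spokesᵥ (_ , joins-sym jn , h , ¬hv)
    present jn (inj₂ (inj₂ h)) (inj₁ refl)           = spokesᵥ (_ , jn , h , ¬hv)
    present jn (inj₂ (inj₁ refl)) (inj₂ (inj₂ h))    = spokesᵤ (_ , joins-sym jn , h , ¬hu)
    present jn (inj₂ (inj₂ h)) (inj₂ (inj₁ refl))    = spokesᵤ (_ , jn , h , ¬hu)
    present {e} jn (inj₂ (inj₂ h)) (inj₂ (inj₂ h′))  = cores e (⇒inside {n} {hub} {e} jn h h′)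

  -- Members off the hubs are pairwise linked, so there are at most two; as the clique has two
  -- vertices more than there are hubs, it contains all hubs and exactly two others.
  clique-elim : ∀ {x} → TriangleFree (On x) → CL n (2 + cnt hub) x →
                (∀ e → inside hub e ≡ true → On x e) × GoodPair (On x)
  clique-elim {x} tri cl with clique-edges cl
  ... | K , size , all = cores , good
    where
    onHub offHub : Fin n → Bool
    onHub  v = K v ∧ hub v
    offHub v = K v ∧ not (hub v)
    rimMember : ∀ {v} → offHub v ≡ true → K v ≡ true × hub v ≡ false
    rimMember {v} h = Bool.∧-conicalˡ (K v) _ h , Bool.not-injective (Bool.∧-conicalʳ (K v) _ h)
    linkedK : ∀ {u v} → u ≢ v → offHub u ≡ true → offHub v ≡ true → Linked (On x) u v
    linkedK ne p q =
      let Ku , hu = rimMember p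
          Kv , hv = rimMember q
          e , j = edge-between ne
      in e , (j , hu , hv) , all {e} j Ku Kv
    total : cnt onHub + cnt offHub ≡ 2 + cnt hub
    total = trans (sym (cnt-split K hub)) size
    few : cnt offHub ≤ 2
    few = ≮⇒≥ λ three → let i , j , k , pi , pj , pk , ji , ki , kj = cnt-three three in
      tri (linkedK (≢-sym ji) pi pj) (linkedK (≢-sym kj) pj pk) (linkedK (≢-sym ki) pi pk)
    hubs : ∀ v → hub v ≡ true → K v ≡ true
    hubs v h = Bool.∧-conicalˡ (K v) (hub v) (cnt-strict {p = onHub} {hub} (λ i → Bool.∧-conicalʳ (K i) (hub i))
      (+-cancelˡ-≤ 2 _ _ (≤-trans (≤-reflexive (sym total))
        (≤-trans (+-monoʳ-≤ (cnt onHub) few) (≤-reflexive (+-comm (cnt onHub) 2))))) v h)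
    two : 2 ≤ cnt offHub
    two = +-cancelʳ-≤ (cnt hub) 2 _ (≤-trans (≤-reflexive (sym total))
      (≤-trans (+-monoˡ-≤ (cnt offHub) (cnt-mono {p = onHub} {hub} λ i → Bool.∧-conicalʳ (K i) (hub i)))
               (≤-reflexive (+-comm (cnt hub) _))))
    cores : ∀ e → inside hub e ≡ true → On x e
    cores e h = let a , b = inside⇒ {n} {hub} {e} (joins-ends e) h in all {e} (joins-ends e) (hubs _ a) (hubs _ b)
    good : GoodPair (On x)
    good = let i , j , pi , pj , ji = cnt-two two in
      i , j , linkedK (≢-sym ji) pi pj ,
      (λ { {e} (h , jn , hh , _) → all {e} jn (hubs h hh) (proj₁ (rimMember pi)) }) ,
      (λ { {e} (h , jn , hh , _) → all {e} jn (hubs h hh) (proj₁ (rimMember pj)) })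

-- The invariant of the clique adversary and its moves

module CliqueStrategy {n : ℕ} (hub : Fin n → Bool) where
  open CliqueGame hub

  Open Yes No : Partial (E n) → Edge → Set
  Open ρ e = ρ e ≡ nothing
  Yes  ρ e = ρ e ≡ just true
  No   ρ e = ρ e ≡ just false

  OpenSpoke OpenRim : Partial (E n) → Fin n → Set
  OpenSpoke ρ w = ∃[ e ] (Spoke e w × Open ρ e)
  OpenRim   ρ w = ∃[ e ] ∃[ v ] (Rim e w v × Open ρ e)

  Statuses : Set
  Statuses = Fin n → Status n

  HasLeaf : Statuses → Fin n → Set
  HasLeaf τ c = ∃[ l ] τ l ≡ leaf c

  -- The clauses guard two things. A clique stays possible: open rim edges join roots, which have no
  -- 0-spoke, and an open spoke belongs to a leaf, or to a root that still has an open rim edge or a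
  -- leaf. No clique is complete: every rim 1-edge has a child end, which has an open spoke or a
  -- 0-spoke.
  record Invariant (ρ : Partial (E n)) (τ : Statuses) : Set where
    field
      core-yes    : ∀ {e} → inside hub e ≡ true → ¬ No ρ e
      spoke-no    : ∀ {e w} → Spoke e w → No ρ e → ∃[ c ] τ w ≡ dead c
      spoke-open  : ∀ {e w c} → Spoke e w → Open ρ e → τ w ≢ dead c
      rim-open    : ∀ {e u v} → Rim e u v → Open ρ e → τ u ≡ root
      useful      : ∀ {w} → OpenSpoke ρ w → τ w ≡ root → OpenRim ρ w ⊎ HasLeaf τ w
      leaf-inv    : ∀ {w c} → τ w ≡ leaf c → OpenSpoke ρ w × τ c ≡ root × Linked (Yes ρ) w c
      dead-inv    : ∀ {w c} → τ w ≡ dead c → ∃[ e ] (Spoke e w × No ρ e)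
      rim-yes     : ∀ {u v} → Linked (Yes ρ) u v → parent (τ u) ≡ just v ⊎ parent (τ v) ≡ just u
      triangleFree : TriangleFree (Yes ρ)

  module _ {A : Set} where
    root≢leaf : ∀ {t : Status n} {c} → t ≡ root → t ≡ leaf c → A
    root≢leaf refl ()
    root≢dead : ∀ {t : Status n} {c} → t ≡ root → t ≡ dead c → A
    root≢dead refl ()
    leaf≢dead : ∀ {t : Status n} {c d} → t ≡ leaf c → t ≡ dead d → A
    leaf≢dead refl ()
    root-parent : ∀ {t : Status n} {c} → t ≡ root → parent t ≡ just c → A
    root-parent refl ()
    open≢yes : ∀ {ρ : Partial (E n)} {e b} → Open ρ e → ρ e ≡ just b → A
    open≢yes {ρ} {e} p q with trans (sym p) q
    ... | ()

  openSpoke? : ∀ ρ w → Dec (OpenSpoke ρ w)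
  openSpoke? ρ w = any? λ e → spoke? e w ×-dec isNothing? (ρ e)

  openRim? : ∀ ρ w → Dec (OpenRim ρ w)
  openRim? ρ w = any? λ e → any? λ v → rim? e w v ×-dec isNothing? (ρ e)

  leaf-injective : ∀ {c d : Fin n} → leaf c ≡ leaf d → c ≡ d
  leaf-injective refl = refl

  module _ {ρ : Partial (E n)} {e : Edge} (un : Open ρ e) where

    other : ∀ {b e′ c} → ρ e′ ≡ just c → (ρ [ e ↦ b ]) e′ ≡ just c
    other h = trans (update-other ρ λ { refl → open≢yes {ρ = ρ} un h }) h

    linked-other : ∀ {b u v} → Linked (Yes ρ) u v → Linked (Yes (ρ [ e ↦ b ])) u v
    linked-other (e′ , r , y) = e′ , r , other y

    linked-false⁻ : ∀ {u v} → Linked (Yes (ρ [ e ↦ false ])) u v → Linked (Yes ρ) u v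
    linked-false⁻ (e′ , r , y) with update-just ρ y
    ... | inj₂ (_ , y′) = e′ , r , y′

    linked-true⁻ : (∀ {u v} → ¬ Rim e u v) → ∀ {u v} → Linked (Yes (ρ [ e ↦ true ])) u v → Linked (Yes ρ) u v
    linked-true⁻ nr (e′ , r , y) with update-just ρ y
    ... | inj₁ (refl , _) = ⊥-elim (nr r)
    ... | inj₂ (_ , y′)   = e′ , r , y′

    no-true⁻ : ∀ {e′} → No (ρ [ e ↦ true ]) e′ → No ρ e′
    no-true⁻ h with update-just ρ h
    ... | inj₂ (_ , h′) = h′

    openSpoke⁻ : ∀ {b w} → OpenSpoke (ρ [ e ↦ b ]) w → OpenSpoke ρ w
    openSpoke⁻ (e′ , s , o) = e′ , s , proj₂ (update-nothing ρ o)

    openSpoke⁺ : ∀ {b w} → ¬ Spoke e w → OpenSpoke ρ w → OpenSpoke (ρ [ e ↦ b ]) w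
    openSpoke⁺ ns (e′ , s , o) = e′ , s , trans (update-other ρ λ { refl → ns s }) o

    openRim⁺ : ∀ {b w} → (∀ {v} → ¬ Rim e w v) → OpenRim ρ w → OpenRim (ρ [ e ↦ b ]) w
    openRim⁺ nr (e′ , v , r , o) = e′ , v , r , trans (update-other ρ λ { refl → nr r }) o

    -- Only the open spoke that `leaf-inv` promises is at risk; `again` provides another one.
    answer-yes : ∀ {τ} → Invariant ρ τ → (∀ {u v} → ¬ Rim e u v) →
                 (∀ {w c} → Spoke e w → τ w ≡ leaf c → OpenSpoke (ρ [ e ↦ true ]) w) →
                 Invariant (ρ [ e ↦ true ]) τ
    answer-yes {τ} inv nr again = record
      { core-yes = λ c h → core-yes c (no-true⁻ h)
      ; spoke-no = λ s h → spoke-no s (no-true⁻ h)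
      ; spoke-open = λ s o → spoke-open s (proj₂ (update-nothing ρ o))
      ; rim-open = λ r o → rim-open r (proj₂ (update-nothing ρ o))
      ; useful = λ o t → [ (λ r → inj₁ (openRim⁺ nr r)) , inj₂ ]′ (useful (openSpoke⁻ o) t)
      ; leaf-inv = λ t → let o , tc , l = leaf-inv t in still t o , tc , linked-other l
      ; dead-inv = λ t → let e′ , s , h = dead-inv t in e′ , s , other h
      ; rim-yes = λ l → rim-yes (linked-true⁻ nr l)
      ; triangleFree = λ a b c → triangleFree (linked-true⁻ nr a) (linked-true⁻ nr b) (linked-true⁻ nr c) }
      where
      open Invariant inv
      still : ∀ {w c} → τ w ≡ leaf c → OpenSpoke ρ w → OpenSpoke (ρ [ e ↦ true ]) w
      still {w} t o with spoke? e w
      ... | yes s = again s t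
      ... | no ns = openSpoke⁺ ns o

    -- The parent `c` may have depended on `w` for `useful`; `spare` gives it another justification.
    answer-dead : ∀ {τ w c} → Invariant ρ τ → Spoke e w → τ w ≡ leaf c →
                  (∀ {b} → ¬ OpenSpoke (ρ [ e ↦ b ]) w) →
                  (OpenSpoke ρ c → OpenRim ρ c ⊎ (∃[ l ] (l ≢ w × τ l ≡ leaf c))) →
                  Invariant (ρ [ e ↦ false ]) (set τ w (dead c))
    answer-dead {τ} {w} {c} inv s t last spare = record
      { core-yes = core-yes′
      ; spoke-no = spoke-no′
      ; spoke-open = spoke-open′
      ; rim-open = λ r o → let o′ = proj₂ (update-nothing ρ o) in keep-root (rim-open r o′)
      ; useful = useful′
      ; leaf-inv = leaf-inv′
      ; dead-inv = dead-inv′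
      ; rim-yes = λ {u} {v} l → [ (λ p → inj₁ (trans (same-parent u) p)) , (λ p → inj₂ (trans (same-parent v) p)) ]′ (rim-yes (linked-false⁻ l))
      ; triangleFree = λ a b c → triangleFree (linked-false⁻ a) (linked-false⁻ b) (linked-false⁻ c) }
      where
      open Invariant inv
      τ′ = set τ w (dead c)
      keep-root : ∀ {v} → τ v ≡ root → τ′ v ≡ root
      keep-root {v} r = trans (set-other τ λ { refl → root≢leaf r t }) r
      same-parent : ∀ v → parent (τ′ v) ≡ parent (τ v)
      same-parent v with v ≟ w
      ... | yes refl = trans (cong parent (set-same τ w (dead c))) (sym (cong parent t))
      ... | no ne    = cong parent (set-other τ ne)
      core-yes′ : ∀ {e′} → inside hub e′ ≡ true → ¬ No (ρ [ e ↦ false ]) e′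
      core-yes′ c h with update-just ρ h
      ... | inj₁ (refl , _) = core-not-spoke c s
      ... | inj₂ (_ , h′)   = core-yes c h′
      spoke-no′ : ∀ {e′ w′} → Spoke e′ w′ → No (ρ [ e ↦ false ]) e′ → ∃[ d ] τ′ w′ ≡ dead d
      spoke-no′ {w′ = w′} s′ h with w′ ≟ w | update-just ρ h
      ... | yes refl | _ = c , set-same τ w (dead c)
      ... | no ne | inj₁ (refl , _) = ⊥-elim (ne (spoke-same s′ s))
      ... | no ne | inj₂ (_ , h′) = let d , q = spoke-no s′ h′ in d , trans (set-other τ ne) q
      spoke-open′ : ∀ {e′ w′ d} → Spoke e′ w′ → Open (ρ [ e ↦ false ]) e′ → τ′ w′ ≢ dead d
      spoke-open′ s′ o q with set-cases τ q
      ... | inj₁ (refl , _) = last (_ , s′ , o)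
      ... | inj₂ (_ , q′)   = spoke-open s′ (proj₂ (update-nothing ρ o)) q′
      nr : ∀ {u v} → ¬ Rim e u v
      nr = spoke-not-rim s
      useful′ : ∀ {w′} → OpenSpoke (ρ [ e ↦ false ]) w′ → τ′ w′ ≡ root → OpenRim (ρ [ e ↦ false ]) w′ ⊎ HasLeaf τ′ w′
      useful′ o q with set-cases τ q
      ... | inj₂ (ne , q′) with useful (openSpoke⁻ o) q′
      ...   | inj₁ r = inj₁ (openRim⁺ nr r)
      ...   | inj₂ (l , tl) with l ≟ w
      ...     | no l≢w = inj₂ (l , trans (set-other τ l≢w) tl)
      ...     | yes refl with leaf-injective (trans (sym t) tl)
      ...       | refl with spare (openSpoke⁻ o)
      ...         | inj₁ r              = inj₁ (openRim⁺ nr r)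
      ...         | inj₂ (l′ , ne′ , tl′) = inj₂ (l′ , trans (set-other τ ne′) tl′)
      leaf-inv′ : ∀ {w′ c′} → τ′ w′ ≡ leaf c′ → OpenSpoke (ρ [ e ↦ false ]) w′ × τ′ c′ ≡ root × Linked (Yes (ρ [ e ↦ false ])) w′ c′
      leaf-inv′ q with set-cases τ q
      ... | inj₂ (ne , q′) = let o , r , l = leaf-inv q′ in
        openSpoke⁺ (λ s′ → ne (spoke-same s′ s)) o , keep-root r , linked-other l
      dead-inv′ : ∀ {w′ c′} → τ′ w′ ≡ dead c′ → ∃[ e′ ] (Spoke e′ w′ × No (ρ [ e ↦ false ]) e′)
      dead-inv′ q with set-cases τ q
      ... | inj₁ (refl , _) = e , s , update-same ρ e false
      ... | inj₂ (_ , q′)   = let e′ , s′ , h = dead-inv q′ in e′ , s′ , other h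

    -- After the exchange `w` has no open spoke, so `useful` asks nothing of it, while `c` becomes a
    -- leaf with open spokes. This requires that no open rim edge and no other leaf relies on `c`
    -- being a root.
    answer-swap : ∀ {τ w c} → Invariant ρ τ → Spoke e w → τ w ≡ leaf c →
                  (∀ {b} → ¬ OpenSpoke (ρ [ e ↦ b ]) w) →
                  OpenSpoke ρ c → ¬ OpenRim ρ c → (∀ {l} → l ≢ w → τ l ≢ leaf c) →
                  Invariant (ρ [ e ↦ true ]) (set (set τ w root) c (leaf w))
    answer-swap {τ} {w} {c} inv s t last oc ¬rc only = record
      { core-yes = λ c h → core-yes c (no-true⁻ h)
      ; spoke-no = λ s′ h → let d , q = spoke-no s′ (no-true⁻ h) in
          d , trans (unchanged (λ { refl → leaf≢dead t q }) (λ { refl → root≢dead c-root q })) q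
      ; spoke-open = spoke-open′
      ; rim-open = λ r o → let o′ = proj₂ (update-nothing ρ o)
                               q = rim-open r o′
                           in trans (unchanged (λ { refl → root≢leaf q t }) (λ { refl → ¬rc (_ , _ , r , o′) })) q
      ; useful = useful′
      ; leaf-inv = leaf-inv′
      ; dead-inv = dead-inv′
      ; rim-yes = rim-yes′
      ; triangleFree = λ a b c → triangleFree (linked-true⁻ nr a) (linked-true⁻ nr b) (linked-true⁻ nr c) }
      where
      open Invariant inv
      τ₁ = set τ w root
      τ′ = set τ₁ c (leaf w)
      c-root : τ c ≡ root
      c-root = proj₁ (proj₂ (leaf-inv t))
      w≢c : w ≢ c
      w≢c refl = root≢leaf c-root t
      unchanged : ∀ {v} → v ≢ w → v ≢ c → τ′ v ≡ τ v
      unchanged nw nc = trans (set-other τ₁ nc) (set-other τ nw)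
      τ′w : τ′ w ≡ root
      τ′w = trans (set-other τ₁ w≢c) (set-same τ w root)
      τ′c : τ′ c ≡ leaf w
      τ′c = set-same τ₁ c (leaf w)
      data Place (v : Fin n) : Set where
        at-w   : v ≡ w → Place v
        at-c   : v ≡ c → Place v
        nowhere : v ≢ w → v ≢ c → Place v
      place : ∀ v → Place v
      place v with v ≟ w | v ≟ c
      ... | yes p | _     = at-w p
      ... | no _  | yes q = at-c q
      ... | no p  | no q  = nowhere p q
      nr : ∀ {u v} → ¬ Rim e u v
      nr = spoke-not-rim s
      spoke-open′ : ∀ {e′ w′ d} → Spoke e′ w′ → Open (ρ [ e ↦ true ]) e′ → τ′ w′ ≢ dead d
      spoke-open′ {w′ = w′} s′ o q with place w′
      ... | at-w refl    = root≢dead τ′w q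
      ... | at-c refl    = leaf≢dead τ′c q
      ... | nowhere a b  = spoke-open s′ (proj₂ (update-nothing ρ o)) (trans (sym (unchanged a b)) q)
      useful′ : ∀ {w′} → OpenSpoke (ρ [ e ↦ true ]) w′ → τ′ w′ ≡ root → OpenRim (ρ [ e ↦ true ]) w′ ⊎ HasLeaf τ′ w′
      useful′ {w′} o q with place w′
      ... | at-w refl = ⊥-elim (last o)
      ... | at-c refl = root≢leaf q τ′c
      ... | nowhere a b with useful (openSpoke⁻ o) (trans (sym (unchanged a b)) q)
      ...   | inj₁ r = inj₁ (openRim⁺ nr r)
      ...   | inj₂ (l , tl) = inj₂ (l , trans (unchanged
              (λ { refl → b (leaf-injective (trans (sym tl) t)) }) (λ { refl → root≢leaf c-root tl })) tl)
      leaf-inv′ : ∀ {w′ c′} → τ′ w′ ≡ leaf c′ → OpenSpoke (ρ [ e ↦ true ]) w′ × τ′ c′ ≡ root × Linked (Yes (ρ [ e ↦ true ])) w′ c′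
      leaf-inv′ {w′} {c′} q with place w′
      ... | at-w refl = root≢leaf τ′w q
      ... | at-c refl with leaf-injective (trans (sym τ′c) q)
      ...   | refl = openSpoke⁺ (λ s′ → w≢c (spoke-same s s′)) oc , τ′w ,
                     linked-other (linked-sym (proj₂ (proj₂ (leaf-inv t))))
      leaf-inv′ {w′} {c′} q | nowhere a b =
        let q′ = trans (sym (unchanged a b)) q
            o , r , l = leaf-inv q′
        in openSpoke⁺ (λ s′ → a (spoke-same s′ s)) o ,
           trans (unchanged (λ { refl → root≢leaf r t }) (λ { refl → only a q′ })) r , linked-other l
      dead-inv′ : ∀ {w′ c′} → τ′ w′ ≡ dead c′ → ∃[ e′ ] (Spoke e′ w′ × No (ρ [ e ↦ true ]) e′)
      dead-inv′ {w′} q with place w′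
      ... | at-w refl   = root≢dead τ′w q
      ... | at-c refl   = leaf≢dead τ′c q
      ... | nowhere a b = let e′ , s′ , h = dead-inv (trans (sym (unchanged a b)) q) in e′ , s′ , other h
      -- Only the link between `w` and `c` changes direction.
      parent′ : ∀ {u v} → parent (τ u) ≡ just v → parent (τ′ u) ≡ just v ⊎ parent (τ′ v) ≡ just u
      parent′ {u} {v} p with place u
      ... | nowhere a b = inj₁ (trans (cong parent (unchanged a b)) p)
      ... | at-c refl   = root-parent c-root p
      ... | at-w refl with trans (sym (cong parent t)) p
      ...   | refl = inj₂ (cong parent τ′c)
      rim-yes′ : ∀ {u v} → Linked (Yes (ρ [ e ↦ true ])) u v → parent (τ′ u) ≡ just v ⊎ parent (τ′ v) ≡ just u
      rim-yes′ l = [ parent′ , swap ∘ parent′ ]′ (rim-yes (linked-true⁻ nr l))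

    module _ {τ u v} (inv : Invariant ρ τ) (r : Rim e u v) where
      open Invariant inv

      private
        u-root : τ u ≡ root
        u-root = rim-open r un
        v-root : τ v ≡ root
        v-root = rim-open (rim-sym r) un

        -- Both ends of an open rim edge are roots, so a common neighbour would have two different
        -- parents.
        common : ∀ {z} → Linked (Yes ρ) z u → Linked (Yes ρ) z v → ⊥
        common zu zv with rim-yes zu | rim-yes zv
        ... | inj₂ p | _      = root-parent u-root p
        ... | inj₁ _ | inj₂ q = root-parent v-root q
        ... | inj₁ p | inj₁ q with trans (sym p) q
        ...   | refl = rim-≢ r refl

        New : Fin n → Fin n → Set
        New a b = (a ≡ u × b ≡ v) ⊎ (a ≡ v × b ≡ u)

        linked-cases : ∀ {a b} → Linked (Yes (ρ [ e ↦ true ])) a b → New a b ⊎ Linked (Yes ρ) a b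
        linked-cases (e′ , r′ , y) with update-just ρ y
        ... | inj₁ (refl , _) = inj₁ (rim-same r′ r)
        ... | inj₂ (_ , y′)   = inj₂ (e′ , r′ , y′)

        linked-≢ : ∀ {Y a b} → Linked Y a b → a ≢ b
        linked-≢ (_ , r′ , _) = rim-≢ r′

        third : ∀ {a b z} → New a b → Linked (Yes (ρ [ e ↦ true ])) z a → Linked (Yes (ρ [ e ↦ true ])) z b → ⊥
        third {a} {b} {z} new za zb with linked-cases za | linked-cases zb | new
        ... | inj₁ (inj₁ (refl , refl)) | _ | inj₁ (refl , refl) = linked-≢ za refl
        ... | inj₁ (inj₂ (refl , refl)) | _ | inj₁ (refl , refl) = linked-≢ zb refl
        ... | inj₁ (inj₁ (refl , refl)) | _ | inj₂ (refl , refl) = linked-≢ zb refl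
        ... | inj₁ (inj₂ (refl , refl)) | _ | inj₂ (refl , refl) = linked-≢ za refl
        ... | inj₂ _ | inj₁ (inj₁ (refl , refl)) | inj₁ (refl , refl) = linked-≢ za refl
        ... | inj₂ _ | inj₁ (inj₂ (refl , refl)) | inj₁ (refl , refl) = linked-≢ zb refl
        ... | inj₂ _ | inj₁ (inj₁ (refl , refl)) | inj₂ (refl , refl) = linked-≢ zb refl
        ... | inj₂ _ | inj₁ (inj₂ (refl , refl)) | inj₂ (refl , refl) = linked-≢ za refl
        ... | inj₂ za′ | inj₂ zb′ | inj₁ (refl , refl) = common za′ zb′
        ... | inj₂ za′ | inj₂ zb′ | inj₂ (refl , refl) = common zb′ za′

      triangleFree-rim : TriangleFree (Yes (ρ [ e ↦ true ]))
      triangleFree-rim ab bc ac with linked-cases ab | linked-cases bc | linked-cases ac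
      ... | inj₁ new | _ | _ = third new (linked-sym ac) (linked-sym bc)
      ... | inj₂ _ | inj₁ new | _ = third new ab ac
      ... | inj₂ _ | inj₂ _ | inj₁ new = third new (linked-sym ab) bc
      ... | inj₂ ab′ | inj₂ bc′ | inj₂ ac′ = triangleFree ab′ bc′ ac′

      -- `closed` and `bare` allow `u` to stop being a root: no open rim edge and no leaf of its own
      -- needs it as one.
      answer-hang : OpenSpoke ρ u → (∀ {b} → ¬ OpenRim (ρ [ e ↦ b ]) u) → ¬ HasLeaf τ u →
                    Invariant (ρ [ e ↦ true ]) (set τ u (leaf v))
      answer-hang ou closed bare = record
        { core-yes = λ c h → core-yes c (no-true⁻ h)
        ; spoke-no = λ s h → let d , q = spoke-no s (no-true⁻ h) in
            d , trans (set-other τ λ { refl → root≢dead u-root q }) q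
        ; spoke-open = spoke-open′
        ; rim-open = λ r′ o → trans (set-other τ λ { refl → closed (_ , _ , r′ , o) })
                                    (rim-open r′ (proj₂ (update-nothing ρ o)))
        ; useful = useful′
        ; leaf-inv = leaf-inv′
        ; dead-inv = dead-inv′
        ; rim-yes = rim-yes′
        ; triangleFree = triangleFree-rim }
        where
        τ′ = set τ u (leaf v)
        τ′u : τ′ u ≡ leaf v
        τ′u = set-same τ u (leaf v)
        ns : ∀ {w} → ¬ Spoke e w
        ns s = spoke-not-rim s r
        spoke-open′ : ∀ {e′ w d} → Spoke e′ w → Open (ρ [ e ↦ true ]) e′ → τ′ w ≢ dead d
        spoke-open′ s o q with set-cases τ q
        ... | inj₂ (_ , q′) = spoke-open s (proj₂ (update-nothing ρ o)) q′
        useful′ : ∀ {w} → OpenSpoke (ρ [ e ↦ true ]) w → τ′ w ≡ root → OpenRim (ρ [ e ↦ true ]) w ⊎ HasLeaf τ′ w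
        useful′ o q with set-cases τ q
        ... | inj₂ (ne , q′) with useful (openSpoke⁻ o) q′
        ...   | inj₂ (l , tl) = inj₂ (l , trans (set-other τ λ { refl → root≢leaf u-root tl }) tl)
        ...   | inj₁ (e′ , z , r′ , o′) with e′ ≟ e
        ...     | no e′≢e = inj₁ (e′ , z , r′ , trans (update-other ρ e′≢e) o′)
        ...     | yes refl with rim-same r′ r
        ...       | inj₁ (refl , _) = ⊥-elim (ne refl)
        -- The open rim edge that made `v` useful was `e` itself; the new leaf `u` replaces it.
        ...       | inj₂ (refl , _) = inj₂ (u , τ′u)
        leaf-inv′ : ∀ {w c} → τ′ w ≡ leaf c → OpenSpoke (ρ [ e ↦ true ]) w × τ′ c ≡ root × Linked (Yes (ρ [ e ↦ true ])) w c
        leaf-inv′ q with set-cases τ q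
        ... | inj₁ (refl , refl) = openSpoke⁺ ns ou , trans (set-other τ (≢-sym (rim-≢ r))) v-root , e , r , update-same ρ e true
        ... | inj₂ (_ , q′) = let o , rt , l = leaf-inv q′ in
          openSpoke⁺ ns o , trans (set-other τ λ { refl → bare (_ , q′) }) rt , linked-other l
        dead-inv′ : ∀ {w c} → τ′ w ≡ dead c → ∃[ e′ ] (Spoke e′ w × No (ρ [ e ↦ true ]) e′)
        dead-inv′ q with set-cases τ q
        ... | inj₂ (_ , q′) = let e′ , s′ , h = dead-inv q′ in e′ , s′ , other h
        old-parent : ∀ {a b} → parent (τ a) ≡ just b → parent (τ′ a) ≡ just b
        old-parent {a} p = trans (cong parent (set-other τ λ { refl → root-parent u-root p })) p
        rim-yes′ : ∀ {a b} → Linked (Yes (ρ [ e ↦ true ])) a b → parent (τ′ a) ≡ just b ⊎ parent (τ′ b) ≡ just a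
        rim-yes′ l with linked-cases l
        ... | inj₁ (inj₁ (refl , refl)) = inj₁ (cong parent τ′u)
        ... | inj₁ (inj₂ (refl , refl)) = inj₂ (cong parent τ′u)
        ... | inj₂ l′ = [ inj₁ ∘ old-parent , inj₂ ∘ old-parent ]′ (rim-yes l′)

      -- A 0 takes an open rim edge only from `u` and `v`, so `useful` is at risk just there.
      answer-no : (∀ {w} → w ≡ u ⊎ w ≡ v → OpenSpoke ρ w → OpenRim (ρ [ e ↦ false ]) w ⊎ HasLeaf τ w) →
                  Invariant (ρ [ e ↦ false ]) τ
      answer-no busy = record
        { core-yes = core-yes′
        ; spoke-no = λ s h → spoke-no s (no′ (λ { refl → spoke-not-rim s r }) h)
        ; spoke-open = λ s o → spoke-open s (proj₂ (update-nothing ρ o))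
        ; rim-open = λ r′ o → rim-open r′ (proj₂ (update-nothing ρ o))
        ; useful = useful′
        ; leaf-inv = λ q → let o , rt , l = leaf-inv q in openSpoke⁺ (λ s → spoke-not-rim s r) o , rt , linked-other l
        ; dead-inv = λ q → let e′ , s′ , h = dead-inv q in e′ , s′ , other h
        ; rim-yes = λ l → rim-yes (linked-false⁻ l)
        ; triangleFree = λ a b c → triangleFree (linked-false⁻ a) (linked-false⁻ b) (linked-false⁻ c) }
        where
        no′ : ∀ {e′} → e′ ≢ e → No (ρ [ e ↦ false ]) e′ → No ρ e′
        no′ ne h = trans (sym (update-other ρ ne)) h
        core-yes′ : ∀ {e′} → inside hub e′ ≡ true → ¬ No (ρ [ e ↦ false ]) e′
        core-yes′ c h = core-yes c (no′ (λ { refl → core-not-rim c r }) h)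
        useful′ : ∀ {w} → OpenSpoke (ρ [ e ↦ false ]) w → τ w ≡ root → OpenRim (ρ [ e ↦ false ]) w ⊎ HasLeaf τ w
        useful′ {w} o q with w ≟ u | w ≟ v
        ... | yes p | _     = busy (inj₁ p) (openSpoke⁻ o)
        ... | no _  | yes p = busy (inj₂ p) (openSpoke⁻ o)
        ... | no a  | no b  = [ (λ rm → inj₁ (openRim⁺ (λ r′ → [ (λ (p , _) → a p) , (λ (p , _) → b p) ]′ (rim-same r′ r)) rm)) , inj₂ ]′
                                (useful (openSpoke⁻ o) q)

-- Playing the clique game to its end

module CliqueAdversary {n : ℕ} (hub : Fin n → Bool) where
  open CliqueGame hub
  open CliqueStrategy hub

  k : ℕ
  k = 2 + cnt hub

  OuterOpen CoreOpen : Partial (E n) → Set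
  OuterOpen ρ = ∃[ e ] (inside hub e ≡ false × Open ρ e)
  CoreOpen  ρ = ∃[ e ] (inside hub e ≡ true × Open ρ e)

  -- Once only edges between hubs are left, each of them is essential.
  record Endgame (ρ : Partial (E n)) : Set where
    field
      core-yes     : ∀ {e} → inside hub e ≡ true → ¬ No ρ e
      outer-done   : ¬ OuterOpen ρ
      core-open    : CoreOpen ρ
      triangleFree : TriangleFree (Yes ρ)
      good         : GoodPair (Yes ρ)

  data Position (ρ : Partial (E n)) : Set where
    middle : ∀ {τ} → Invariant ρ τ → OuterOpen ρ → Position ρ
    ending : Endgame ρ → Position ρ

  Final : Partial (E n) → Edge → Set
  Final ρ e = (∀ {j} → j ≢ e → ρ j ≢ nothing)
            × (∀ {x} → ρ [ e ↦ true ] ⊑ x → CL n k x)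
            × (∀ {x} → ρ [ e ↦ false ] ⊑ x → ¬ CL n k x)

  Answer : Partial (E n) → Edge → Set
  Answer ρ e = (∃[ b ] Position (ρ [ e ↦ b ])) ⊎ Final ρ e

  outerOpen? : ∀ ρ → Dec (OuterOpen ρ)
  outerOpen? ρ = any? λ e → (inside hub e Bool.≟ false) ×-dec isNothing? (ρ e)

  coreOpen? : ∀ ρ → Dec (CoreOpen ρ)
  coreOpen? ρ = any? λ e → (inside hub e Bool.≟ true) ×-dec isNothing? (ρ e)

  yes-by-elimination : ∀ (ρ : Partial (E n)) {e} → ¬ Open ρ e → ¬ No ρ e → Yes ρ e
  yes-by-elimination ρ {e} no-open not-no with ρ e
  ... | nothing    = ⊥-elim (no-open refl)
  ... | just true  = refl
  ... | just false = ⊥-elim (not-no refl)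

  Complete : Partial (E n) → Set
  Complete ρ = ∀ e → ¬ Open ρ e

  complete : ∀ {ρ} → ¬ OuterOpen ρ → ¬ CoreOpen ρ → Complete ρ
  complete no-outer no-core e o with inside hub e in eq
  ... | true  = no-core (e , eq , o)
  ... | false = no-outer (e , eq , o)

  complete-yes : ∀ {ρ x} → Complete ρ → ρ ⊑ x → ∀ {e} → On x e → Yes ρ e
  complete-yes {ρ} c s {e} h = yes-by-elimination ρ (c e) λ q → true≢false h (s e q)

  goodPair-map : ∀ {Y Z : Edge → Set} → (∀ {e} → Y e → Z e) → GoodPair Y → GoodPair Z
  goodPair-map f (u , v , (e , r , y) , su , sv) = u , v , (e , r , f y) , (λ s → f (su s)) , (λ s → f (sv s))

  triangleFree-map : ∀ {Y Z : Edge → Set} → (∀ {e} → Z e → Y e) → TriangleFree Y → TriangleFree Z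
  triangleFree-map f t (e , r , y) (e′ , r′ , y′) (e″ , r″ , y″) = t (e , r , f y) (e′ , r′ , f y′) (e″ , r″ , f y″)

  accept : ∀ {ρ x} → (∀ {e} → inside hub e ≡ true → ¬ No ρ e) → Complete ρ → GoodPair (Yes ρ) → ρ ⊑ x → CL n k x
  accept {ρ} cores c good s = clique-intro
    (λ e h → s e (yes-by-elimination ρ (c e) (cores h)))
    (goodPair-map (λ {e} y → s e y) good)

  -- The child end of a rim 1-edge spoils the pair: a leaf would still have an open spoke, and a
  -- dead vertex has a 0-spoke.
  no-good-pair : ∀ {ρ τ} → Invariant ρ τ → Complete ρ → ¬ GoodPair (Yes ρ)
  no-good-pair {ρ} {τ} inv c (u , v , l , su , sv) =
    [ (λ p → child su p) , (λ p → child sv p) ]′ (rim-yes l)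
    where
    open Invariant inv
    child : ∀ {a b} → (∀ {e} → Spoke e a → Yes ρ e) → parent (τ a) ≡ just b → ⊥
    child {a} s p with τ a in eq
    ... | leaf _ = let (e , _ , o) , _ = leaf-inv eq in c e o
    ... | dead _ = let e , sp , h = dead-inv eq in yes≢no (s sp) h
      where
      yes≢no : ∀ {m : Maybe Bool} → m ≡ just true → m ≡ just false → ⊥
      yes≢no refl ()

  reject : ∀ {ρ τ x} → Invariant ρ τ → Complete ρ → ρ ⊑ x → ¬ CL n k x
  reject inv c s cl = no-good-pair inv c (goodPair-map (complete-yes c s)
    (proj₂ (clique-elim (triangleFree-map (complete-yes c s) (Invariant.triangleFree inv)) cl)))

  module _ {ρ : Partial (E n)} {e : Edge} (un : Open ρ e) where

    outer⁺ : ∀ {b} → inside hub e ≡ true → OuterOpen ρ → OuterOpen (ρ [ e ↦ b ])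
    outer⁺ c (j , h , o) = j , h , trans (update-other ρ λ { refl → true≢false c h }) o

    outer-spoke : ∀ {b w} → OpenSpoke (ρ [ e ↦ b ]) w → OuterOpen (ρ [ e ↦ b ])
    outer-spoke (j , s , o) = j , spoke-outer s , o

    outer-rim : ∀ {b w} → OpenRim (ρ [ e ↦ b ]) w → OuterOpen (ρ [ e ↦ b ])
    outer-rim (j , _ , r , o) = j , rim-outer r , o

    done-other : ∀ {b c} → ¬ OuterOpen (ρ [ e ↦ b ]) → ¬ OuterOpen (ρ [ e ↦ c ])
    done-other d (j , h , o) = let ne , o′ = update-nothing ρ o in d (j , h , trans (update-other ρ ne) o′)

    core-other : ∀ {b c} → ¬ CoreOpen (ρ [ e ↦ b ]) → ¬ CoreOpen (ρ [ e ↦ c ])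
    core-other d (j , h , o) = let ne , o′ = update-nothing ρ o in d (j , h , trans (update-other ρ ne) o′)

    queried : ∀ {b} → Complete (ρ [ e ↦ b ]) → ∀ {j} → j ≢ e → ρ j ≢ nothing
    queried c {j} ne o = c j (trans (update-other ρ ne) o)

    -- An answer 0 that would leave no edge outside the hubs is replaced by 1.
    settle : ∀ {τ τ′} → Invariant ρ τ → Invariant (ρ [ e ↦ false ]) τ′ →
             (¬ OuterOpen (ρ [ e ↦ true ]) → GoodPair (Yes (ρ [ e ↦ true ]))) →
             TriangleFree (Yes (ρ [ e ↦ true ])) → Answer ρ e
    settle inv inv₀ good tri with outerOpen? (ρ [ e ↦ false ])
    ... | yes o = inj₁ (false , middle inv₀ o)
    ... | no ¬o with coreOpen? (ρ [ e ↦ true ])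
    ...   | yes c = inj₁ (true , ending record
              { core-yes = λ h q → Invariant.core-yes inv h (no-true⁻ un q)
              ; outer-done = done-other ¬o ; core-open = c ; triangleFree = tri ; good = good (done-other ¬o) })
    -- Here `e` is the last open edge of all. The invariant after a 0, `inv₀`, excludes good pairs
    -- in a complete position, so the 0 rejects.
    ...   | no ¬c = inj₂ (queried c₁ ,
              accept (λ h q → Invariant.core-yes inv h (no-true⁻ un q)) c₁ (good (done-other ¬o)) ,
              reject inv₀ (complete ¬o (core-other ¬c)))
      where
      c₁ : Complete (ρ [ e ↦ true ])
      c₁ = complete (done-other ¬o) ¬c

    all-spokes : ∀ {τ a} → Invariant ρ τ → ¬ OuterOpen (ρ [ e ↦ true ]) → (∀ {c} → τ a ≢ dead c) →
                 ∀ {j} → Spoke j a → Yes (ρ [ e ↦ true ]) j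
    all-spokes inv d alive {j} s = yes-by-elimination (ρ [ e ↦ true ])
      (λ o → d (j , spoke-outer s , o))
      (λ q → alive (proj₂ (Invariant.spoke-no inv s (no-true⁻ un q))))

    answer-leaf : ∀ {τ w c} → Invariant ρ τ → Spoke e w → τ w ≡ leaf c → Answer ρ e
    answer-leaf {τ} {w} {c} inv s t with openSpoke? (ρ [ e ↦ true ]) w
    ... | yes o = inj₁ (true , middle (answer-yes un inv (spoke-not-rim s)
            (λ s′ _ → subst (OpenSpoke (ρ [ e ↦ true ])) (spoke-same s s′) o)) (outer-spoke o))
    ... | no last = decide (openSpoke? ρ c) (openRim? ρ c) (any? λ l → ¬? (l ≟ w) ×-dec isLeaf? (τ l) c)
      where
      open Invariant inv
      c-root : τ c ≡ root
      c-root = proj₁ (proj₂ (leaf-inv t))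
      last′ : ∀ {b} → ¬ OpenSpoke (ρ [ e ↦ b ]) w
      last′ (j , s′ , o) = let ne , o′ = update-nothing ρ o in last (j , s′ , trans (update-other ρ ne) o′)
      -- Neither `w` nor its parent is dead, so none of their spokes was answered 0.
      good : ¬ OuterOpen (ρ [ e ↦ true ]) → GoodPair (Yes (ρ [ e ↦ true ]))
      good d = w , c , linked-other un (proj₂ (proj₂ (leaf-inv t))) ,
        all-spokes inv d (λ q → leaf≢dead t q) , all-spokes inv d (λ q → root≢dead c-root q)
      old : ∀ {u v} → Linked (Yes (ρ [ e ↦ true ])) u v → Linked (Yes ρ) u v
      old = linked-true⁻ un (spoke-not-rim s)
      drop : (OpenSpoke ρ c → OpenRim ρ c ⊎ (∃[ l ] (l ≢ w × τ l ≡ leaf c))) → Answer ρ e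
      drop spare = settle inv (answer-dead un inv s t last′ spare) good
        (λ a b c → triangleFree (old a) (old b) (old c))
      decide : Dec (OpenSpoke ρ c) → Dec (OpenRim ρ c) → Dec (∃[ l ] (l ≢ w × τ l ≡ leaf c)) → Answer ρ e
      decide (no ¬oc) _ _ = drop λ oc → ⊥-elim (¬oc oc)
      decide _ (yes rc) _ = drop λ _ → inj₁ rc
      decide _ _ (yes l)  = drop λ _ → inj₂ l
      decide (yes oc) (no ¬rc) (no ¬l) = inj₁ (true , middle
        (answer-swap un inv s t last′ oc ¬rc (λ ne tl → ¬l (_ , ne , tl)))
        (outer-spoke (openSpoke⁺ un
          (λ s′ → root≢leaf c-root (subst (λ z → τ z ≡ leaf c) (spoke-same s s′) t)) oc)))

    answer-spoke : ∀ {τ w} → Invariant ρ τ → Spoke e w → Answer ρ e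
    answer-spoke {τ} {w} inv s with τ w in t
    ... | dead c = ⊥-elim (Invariant.spoke-open inv s un t)
    ... | leaf c = answer-leaf inv s t
    ... | root   = inj₁ (true , middle (answer-yes un inv (spoke-not-rim s)
                     (λ s′ q → root≢leaf t (subst (λ z → τ z ≡ leaf _) (spoke-same s′ s) q))) remaining)
      where
      open Invariant inv
      -- What makes `w` useful is an open edge other than `e`: a rim edge at `w`, or a spoke of a
      -- leaf of `w`.
      remaining : OuterOpen (ρ [ e ↦ true ])
      remaining with useful (e , s , un) t
      ... | inj₁ r = outer-rim (openRim⁺ un (spoke-not-rim s) r)
      ... | inj₂ (l , tl) = outer-spoke (openSpoke⁺ un
              (λ s′ → root≢leaf (subst (λ z → τ z ≡ root) (spoke-same s s′) t) tl) (proj₁ (leaf-inv tl)))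

    -- Which edges remain open does not depend on the answer, so the test may be made with a 0
    -- although hanging answers 1.
    hang? : ∀ τ w → Dec (OpenSpoke ρ w × (¬ OpenRim (ρ [ e ↦ false ]) w × ¬ HasLeaf τ w))
    hang? τ w = openSpoke? ρ w ×-dec (¬? (openRim? (ρ [ e ↦ false ]) w) ×-dec ¬? (any? λ l → isLeaf? (τ l) w))

    hang : ∀ {τ u v} → Invariant ρ τ → Rim e u v →
           OpenSpoke ρ u × (¬ OpenRim (ρ [ e ↦ false ]) u × ¬ HasLeaf τ u) → Answer ρ e
    hang inv r (o , closed , bare) = inj₁ (true , middle (answer-hang un inv r o closed′ bare)
      (outer-spoke (openSpoke⁺ un (λ s → spoke-not-rim s r) o)))
      where
      closed′ : ∀ {b} → ¬ OpenRim (ρ [ e ↦ b ]) _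
      closed′ (j , z , r′ , o′) = let ne , o″ = update-nothing ρ o′ in
        closed (j , z , r′ , trans (update-other ρ ne) o″)

    answer-rim : ∀ {τ u v} → Invariant ρ τ → Rim e u v → Answer ρ e
    answer-rim {τ} {u} {v} inv r with hang? τ u | hang? τ v
    -- If both ends qualify, hanging `u` suffices: `v` then has a leaf.
    ... | yes h | _     = hang inv r h
    ... | no _  | yes h = hang inv (rim-sym r) h
    ... | no a  | no b  = settle inv (answer-no un inv r λ { (inj₁ refl) → busy a ; (inj₂ refl) → busy b })
                            good (triangleFree-rim un inv r)
      where
      open Invariant inv
      busy : ∀ {w} → ¬ (OpenSpoke ρ w × (¬ OpenRim (ρ [ e ↦ false ]) w × ¬ HasLeaf τ w)) →
             OpenSpoke ρ w → OpenRim (ρ [ e ↦ false ]) w ⊎ HasLeaf τ w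
      busy {w} f o with openRim? (ρ [ e ↦ false ]) w | any? (λ l → isLeaf? (τ l) w)
      ... | yes rw | _     = inj₁ rw
      ... | no _   | yes l = inj₂ l
      ... | no p   | no q  = ⊥-elim (f (o , p , q))
      good : ¬ OuterOpen (ρ [ e ↦ true ]) → GoodPair (Yes (ρ [ e ↦ true ]))
      good d = u , v , (e , r , update-same ρ e true) ,
        all-spokes inv d (λ q → root≢dead (rim-open r un) q) ,
        all-spokes inv d (λ q → root≢dead (rim-open (rim-sym r) un) q)

    answer-middle : ∀ {τ} → Invariant ρ τ → OuterOpen ρ → Answer ρ e
    answer-middle inv o with kind e
    ... | spoke s = answer-spoke inv s
    ... | rim r   = answer-rim inv r
    ... | core c  = inj₁ (true , middle
            (answer-yes un inv (core-not-rim c) (λ s → ⊥-elim (core-not-spoke c s))) (outer⁺ c o))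

    answer-ending : Endgame ρ → Answer ρ e
    answer-ending g with kind e
    ... | spoke s = ⊥-elim (Endgame.outer-done g (e , spoke-outer s , un))
    ... | rim r   = ⊥-elim (Endgame.outer-done g (e , rim-outer r , un))
    ... | core c with coreOpen? (ρ [ e ↦ true ])
    ...   | yes o = inj₁ (true , ending record
              { core-yes = cores ; outer-done = done ; core-open = o
              ; triangleFree = λ a b c → triangleFree (old a) (old b) (old c)
              ; good = goodPair-map (other un) good })
      where
      open Endgame g
      cores : ∀ {j} → inside hub j ≡ true → ¬ No (ρ [ e ↦ true ]) j
      cores h q = core-yes h (no-true⁻ un q)
      done : ∀ {b} → ¬ OuterOpen (ρ [ e ↦ b ])
      done (j , h , o) = outer-done (j , h , proj₂ (update-nothing ρ o))
      old : ∀ {u v} → Linked (Yes (ρ [ e ↦ true ])) u v → Linked (Yes ρ) u v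
      old = linked-true⁻ un (core-not-rim c)
    -- Triangle-freeness makes every k-clique use all core edges, so a 0 on the last one rules them
    -- all out.
    ...   | no ¬o = inj₂ (queried (complete done ¬o) ,
              accept cores (complete done ¬o) (goodPair-map (other un) good) ,
              λ s cl → true≢false (proj₁ (clique-elim (tri s) cl) e c) (⊑-at ρ s))
      where
      open Endgame g
      cores : ∀ {j} → inside hub j ≡ true → ¬ No (ρ [ e ↦ true ]) j
      cores h q = core-yes h (no-true⁻ un q)
      done : ∀ {b} → ¬ OuterOpen (ρ [ e ↦ b ])
      done (j , h , o) = outer-done (j , h , proj₂ (update-nothing ρ o))
      tri : ∀ {x} → ρ [ e ↦ false ] ⊑ x → TriangleFree (On x)
      tri s a b c = triangleFree (old a) (old b) (old c)
        where
        old : ∀ {u v} → Linked (On _) u v → Linked (Yes ρ) u v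
        old (j , r , y) = linked-false⁻ un (j , r , complete-yes (complete done (core-other ¬o)) s y)

  cliqueAdversary : Adversary (CL n k) (CL n k) Position
  cliqueAdversary = record
    { live   = λ { (middle _ (e , _ , o)) → e , o ; (ending g) → let e , _ , o = Endgame.core-open g in e , o }
    ; answer = λ { (middle inv o) un → answer-middle un inv o ; (ending g) un → answer-ending un g } }

  -- A second vertex off the hubs gives each such vertex the open rim edge that `useful` demands.
  start : 2 ≤ cnt (not ∘ hub) → Position (λ _ → nothing)
  start two with cnt-two two
  ... | i , j , ¬i , ¬j , j≢i = middle {τ = λ _ → root} inv (let e , jn = edge-between j≢i in e , rim-outer (jn , unhub ¬j , unhub ¬i) , refl)
    where
    unhub : ∀ {v} → not (hub v) ≡ true → hub v ≡ false
    unhub = Bool.not-injective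
    partner : ∀ w → ∃[ z ] (w ≢ z × hub z ≡ false)
    partner w with w ≟ i
    ... | yes refl = j , ≢-sym j≢i , unhub ¬j
    ... | no ne    = i , ne , unhub ¬i
    inv : Invariant (λ _ → nothing) (λ _ → root)
    inv = record
      { core-yes = λ _ () ; spoke-no = λ _ () ; spoke-open = λ _ _ () ; rim-open = λ _ _ → refl
      ; useful = λ { {w} (_ , (_ , _ , _ , ¬hw) , _) _ →
          let z , ne , ¬hz = partner w
              e , jn = edge-between ne
          in inj₁ (e , z , (jn , ¬hw , ¬hz) , refl) }
      ; leaf-inv = λ () ; dead-inv = λ () ; rim-yes = λ { (_ , _ , ()) } ; triangleFree = λ { (_ , _ , ()) } }

-- Evasiveness of cliques and the conclusion

clique-hard : ∀ n k → 2 ≤ k → k ≤ n → ∀ T → Computes (CL n k) T →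
              ∃[ x ] (E n ≤ cost T x × ∃[ S ] (IsCert (CL n k) x S × ∣ S ∣ ≤ E k))
clique-hard n (suc (suc h)) (s≤s (s≤s z≤n)) k≤n with shrink {n} (λ _ → true) h
    (≤-trans (m≤n+m h 2) (≤-trans k≤n (≤-reflexive (sym (cnt-all {n} λ _ → refl)))))
... | hub , refl , _ = λ T c →
  let x , cl , le = adversary-hard (λ q → q) cliqueAdversary (start two) T c
  in x , le , clique⇒cert cl
  where
  open CliqueAdversary hub
  two : 2 ≤ cnt (not ∘ hub)
  two = +-cancelˡ-≤ (cnt hub) 2 _ (≤-trans (≤-reflexive (+-comm (cnt hub) 2)) (≤-trans k≤n
    (≤-reflexive (trans (sym (cnt-all {n} λ _ → refl)) (cnt-split {n} (λ _ → true) hub)))))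

cube-bound : ∀ n k → 2 ≤ k → k ^ 3 * 2 ^ 3 ≤ n ^ 2 → k ≤ n
cube-bound n k@(suc _) 2≤k big = ≮⇒≥ λ n<k → <-irrefl refl (begin-strict
  n ^ 2         ≡⟨ cong (n *_) (*-identityʳ n) ⟩
  n * n         <⟨ *-mono-< n<k n<k ⟩
  k * k         ≤⟨ *-monoʳ-≤ k (≤-trans (m≤m*n k (k * 1)) (m≤m*n (k * (k * 1)) 8)) ⟩
  k * (k * (k * 1) * 8) ≡⟨ *-assoc k (k * (k * 1)) 8 ⟨
  k ^ 3 * 2 ^ 3 ≤⟨ big ⟩
  n ^ 2         ∎)
  where open ≤-Reasoning

clique-theorem : ∀ n k → 2 ≤ k → k ^ 3 * 2 ^ 3 ≤ n ^ 2 →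
  ∃[ d ] ∃[ m ] (IsDT (CL n k) d × IsCmin (CL n k) m × 1 ≤ m × IsInstC (CL n k) d m × d * (k C 2) ≡ (n C 2) * m)
clique-theorem n k@(suc (suc _)) 2≤k@(s≤s (s≤s _)) big = E n , E k ,
  evasive⇒IsDT ext dec cert hard , evasive⇒IsCmin ext dec cert hard , s≤s z≤n ,
  evasive⇒IsInstC ext dec cert hard , cong₂ _*_ (E≡C2 n) (sym (E≡C2 k))
  where
  ext = λ {x} {y} → clique-ext n k {x} {y}
  dec = clique? n k
  cert = clique-cert-≥ n k big
  hard = clique-hard n k 2≤k (cube-bound n k 2≤k big)

theorem4p3 : (∀ (n : ℕ) → 2 ≤ n →
    ∃[ d ] ∃[ m ] (IsDT (CONN n) d × IsCmin (CONN n) m × 1 ≤ m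
    × IsInstC (CONN n) d m
    × d * (n ∸ 1) ≡ (n C 2) * m))
    ×
    (∃[ p ] ∃[ q ] (1 ≤ p × 1 ≤ q ×
    (∀ (n k : ℕ) → 2 ≤ n → 2 ≤ k → (k ^ 3) * (q ^ 3) ≤ (p ^ 3) * (n ^ 2) →
    ∃[ d ] ∃[ m ] (IsDT (CL n k) d × IsCmin (CL n k) m × 1 ≤ m
    × IsInstC (CL n k) d m
    × d * (k C 2) ≡ (n C 2) * m))))
-- The constant is c = 1/2: cubing k ≤ c n^(2/3) gives 8k³ ≤ n², the hypothesis of
-- `turán-arithmetic`.
theorem4p3 = conn-theorem , 1 , 2 , s≤s z≤n , s≤s z≤n ,
  λ n k _ 2≤k h → clique-theorem n k 2≤k (≤-trans h (≤-reflexive (*-identityˡ (n ^ 2))))
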